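{- For every integer $r > 7000$ we have $\pi_{K_{r,r}}(\mathcal T_{2r}) = \frac12$, where $\mathcal T_{2r}$ is the family of spanning trees on $2r$ vertices (i.e. all trees with $2r$ vertices) and $K_{r,r}$ is the complete bipartite graph with $r$ vertices on each side.
   Context: Graphs are finite and simple. Let $H$ be a graph on vertex set $\{v_1,\dots,v_m\}$. An $H$-partite graph $G$ is a graph with a vertex partition $V=V_1\sqcup\dots\sqcup V_m$ into nonempty parts such that there are no edges inside any part, and no edges between $V_i$ and $V_j$ unless $v_iv_j\in E(H)$. For disjoint nonempty vertex sets $X,Y$, the edge density is $d(X,Y)=\frac{e(X,Y)}{|X||Y|}$, where $e(X,Y)$ is the number of edges between $X$ and $Y$. The $H$-partite density of $G$ is $d_H(G)=\min\{d(V_i,V_j): 1\le i<j\le m,\ v_iv_j\in E(H)\}$. A traversal of $G$ is a subgraph (on $m$ vertices) containing exactly one vertex from each part. For a family $\mathcal F$ of graphs, $G$ contains an $\mathcal F$-traversal if some traversal of $G$ contains a member of $\mathcal F$ as a subgraph (up to isomorphism); thus a $\mathcal T_m$-traversal is the same as a connected traversal. The critical density is $$\pi_H(\mathcal F)=\sup\{\alpha\in[0,1]: \text{there exists an } H\text{ -partite graph } G \text{ with } d_H(G)\ge\alpha \text{ and no } \mathcal F\text{ -traversal}\}.$$ -}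

module Defs where

open import Level using (0ℓ)
open import Data.Bool using (Bool; true; false)
import Data.Bool.Properties as Bool
open import Data.Nat using (ℕ; suc; NonZero; >-nonZero)
import Data.Nat as ℕ
import Data.Nat.Properties as ℕ
open import Data.Integer using (+_)
open import Data.Rational using (ℚ; 0ℚ; 1ℚ; _≤_; _/_)
import Data.Rational.Properties as ℚ
open import Data.Fin using (Fin; zero; suc; inject₁; fromℕ; splitAt)
import Data.Fin as Fin
import Data.Fin.Properties as Fin
open import Data.Fin.Subset using (Subset; _∈_; ∣_∣; Nonempty)
open import Data.Fin.Subset.Properties using (_∈?_; p⊆q⇒∣p∣≤∣q∣; ∣⁅x⁆∣≡1; x∈⁅y⁆⇒x≡y)
open import Data.List using (List; length; map; filter; allFin; cartesianProduct)
import Data.List.Extrema as Extrema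
open import Data.Product using (Σ-syntax; ∃-syntax; ∃!; _×_; _,_)
open import Data.Sum using ([_,_]′)
open import Function using (const; _∘_)
open import Function.Definitions using (Injective)
open import Relation.Binary using (Rel; Decidable; Symmetric; Irreflexive; DecTotalOrder)
open import Relation.Binary.Construct.Closure.ReflexiveTransitive using (Star)
open import Relation.Binary.PropositionalEquality
  using (_≡_; _≢_; refl; sym; subst; ≢-sym)
open import Relation.Nullary using (¬_)
open import Relation.Nullary.Decidable using (¬?; _×-dec_)

record Graph (n : ℕ) : Set₁ where
  field
    Adj    : Rel (Fin n) 0ℓ
    adj?   : Decidable Adj
    symm   : Symmetric Adj
    irrefl : Irreflexive _≡_ Adj

open Graph public

-- A copy of S in G, that is, a (not necessarily induced) subgraph of G whose
-- vertices are labelled by those of S.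
record Copy {k n : ℕ} (S : Graph k) (G : Graph n) : Set where
  field
    vertex    : Fin k → Fin n
    injective : Injective _≡_ _≡_ vertex
    edge      : ∀ {u v} → Adj S u v → Adj G (vertex u) (vertex v)

open Copy public

side : ∀ r s → Fin (r ℕ.+ s) → Bool
side r s = [ const true , const false ]′ ∘ splitAt r

K : ∀ r s → Graph (r ℕ.+ s)
K r s = record
  { Adj    = λ u v → side r s u ≢ side r s v
  ; adj?   = λ u v → ¬? (side r s u Bool.≟ side r s v)
  ; symm   = ≢-sym
  ; irrefl = λ { refl u≢u → u≢u refl }
  }

Connected : ∀ {n} → Graph n → Set
Connected {n} G = Fin n × (∀ (u v : Fin n) → Star (Adj G) u v)

-- A cycle of length suc l ≥ 3: the vertices c 0, …, c l are distinct,
-- consecutive ones are adjacent, and c l is adjacent to c 0.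
record Cycle {n : ℕ} (G : Graph n) : Set where
  field
    {l}      : ℕ
    long     : 2 ℕ.≤ l
    c        : Fin (suc l) → Fin n
    distinct : Injective _≡_ _≡_ c
    step     : ∀ (i : Fin l) → Adj G (c (inject₁ i)) (c (suc i))
    close    : Adj G (c (fromℕ l)) (c zero)

IsTree : ∀ {n} → Graph n → Set
IsTree G = Connected G × ¬ Cycle G

Family : Set₁
Family = ∀ {k} → Graph k → Set

𝒯 : ℕ → Family
𝒯 m {k} T = k ≡ m × IsTree T

record Partite {m n : ℕ} (H : Graph m) (G : Graph n) : Set where
  field
    part        : Fin m → Subset n
    nonempty    : ∀ i → Nonempty (part i)
    partition   : ∀ v → ∃! _≡_ λ i → v ∈ part i
    independent : ∀ {i u v} → u ∈ part i → v ∈ part i → ¬ Adj G u v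
    between     : ∀ {i j u v} → i ≢ j → u ∈ part i → v ∈ part j →
                  Adj G u v → Adj H i j

open Partite public

-- The pairs are ordered, so each edge is counted once when X and Y are
-- disjoint, the only case in which e is used.
e : ∀ {n} → Graph n → Subset n → Subset n → ℕ
e {n} G X Y = length (filter
  (λ (x , y) → (x ∈? X) ×-dec (y ∈? Y) ×-dec adj? G x y)
  (cartesianProduct (allFin n) (allFin n)))

∣∣-nonZero : ∀ {n} {X : Subset n} → Nonempty X → NonZero ∣ X ∣
∣∣-nonZero {X = X} (x , x∈X) = >-nonZero (subst (ℕ._≤ ∣ X ∣) (∣⁅x⁆∣≡1 x)
  (p⊆q⇒∣p∣≤∣q∣ λ y∈⁅x⁆ → subst (_∈ X) (sym (x∈⁅y⁆⇒x≡y x y∈⁅x⁆)) x∈X))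

density : ∀ {n} (G : Graph n) (X Y : Subset n) → Nonempty X → Nonempty Y → ℚ
density G X Y X≢∅ Y≢∅ = _/_ (+ e G X Y) (∣ X ∣ ℕ.* ∣ Y ∣)
  {{ℕ.m*n≢0 ∣ X ∣ ∣ Y ∣ {{∣∣-nonZero X≢∅}} {{∣∣-nonZero Y≢∅}}}}

edges : ∀ {m} → Graph m → List (Fin m × Fin m)
edges {m} H = filter (λ (i , j) → (i Fin.<? j) ×-dec adj? H i j)
  (cartesianProduct (allFin m) (allFin m))

-- Densities between disjoint sets are at most 1, so starting the minimum at 1ℚ
-- affects only the case in which H has no edges.
partiteDensity : ∀ {m n} (H : Graph m) (G : Graph n) → Partite H G → ℚ
partiteDensity H G P = Extrema.min (DecTotalOrder.totalOrder ℚ.≤-decTotalOrder) 1ℚ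
  (map (λ (i , j) → density G (part P i) (part P j) (nonempty P i) (nonempty P j))
       (edges H))

IsTraversal : ∀ {m n} {H : Graph m} {G : Graph n} → Partite H G →
              {S : Graph m} → Copy S G → Set
IsTraversal P φ = ∀ i → ∃! _≡_ λ s → vertex φ s ∈ part P i

HasTraversal : ∀ {m n} {H : Graph m} {G : Graph n} → Family → Partite H G → Set₁
HasTraversal {m} {G = G} ℱ P =
  Σ[ S ∈ Graph m ] Σ[ φ ∈ Copy S G ] IsTraversal P φ ×
  (∃[ k ] Σ[ F ∈ Graph k ] ℱ F × Copy F S)

Admissible : ∀ {m} → Graph m → Family → ℚ → Set₁
Admissible H ℱ α = 0ℚ ≤ α × α ≤ 1ℚ ×
  (∃[ n ] Σ[ G ∈ Graph n ] Σ[ P ∈ Partite H G ]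
    α ≤ partiteDensity H G P × ¬ HasTraversal ℱ P)

IsSupremum : (ℚ → Set₁) → ℚ → Set₁
IsSupremum A s = (∀ α → A α → α ≤ s) × (∀ β → (∀ α → A α → α ≤ β) → s ≤ β)

-- π_H(ℱ) = s for rational s.  Letting α and the upper bounds range over ℚ rather
-- than ℝ does not change this: densities are rational, so the real set of
-- admissible α has the same supremum as its set of rational members, and by
-- density of ℚ a rational is the supremum in ℚ iff it is the supremum in ℝ.
CriticalDensity≡ : ∀ {m} → Graph m → Family → ℚ → Set₁
CriticalDensity≡ H ℱ s = IsSupremum (Admissible H ℱ) s

{-# OPTIONS --safe #-}
-- Lower bound: give the vertices labels 0 and 1 and join equal labels only.  If two of the
-- left parts carry different fixed labels, every traversal is disconnected.
--
-- Upper bound: rescale the vertex weights so that every part has mass N; a vertex is good if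
-- it sees more than half of the other side, and by averaging every part contains a good
-- vertex.  Two good vertices of one side always have a common neighbour.  Let g be a vertex of
-- maximal degree on the left (the sides are exchanged if the right has larger degrees) and
-- y a good vertex on the right.  Either every good vertex on the left shares a fifth of the
-- right side with g, or some g′ does not; then g and g′, joined through a common neighbour,
-- see so much together that the neighbourhood of every good vertex shares a definite mass
-- with theirs and every good vertex on the right can be linked to them robustly.  The same
-- holds for y.  If neither g′ nor its analogue y′ is needed, then g and y are linked by a path
-- g – v – u – y: otherwise the degrees of the vertices adjacent to y would be too small, by
-- the maximality of g.  In all cases a bounded number of vertices forms a connected core with
-- which every good vertex shares a fifth of the other side, and a greedy choice of r / 10
-- common neighbours attaches good vertices in all the remaining parts at once.
module Submission where

open import Defs
open import Data.Bool using (Bool; true; false; _∧_; _∨_; not; T)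
open import Data.Bool.Properties using (∧-assoc; ¬-not; not-injective) renaming (_≟_ to _≟ᵇ_)
open import Data.Fin using (Fin; zero; suc; inject₁; fromℕ; toℕ; splitAt; _↑ˡ_; _↑ʳ_; combine; remQuot)
import Data.Fin as Fin
import Data.Fin.Properties as Fin
open import Data.Fin.Relation.Unary.Top using (view; ‵fromℕ; ‵inject₁)
open import Data.Fin.Subset using (Subset; ∣_∣) renaming (_∈_ to _∈ₛ_)
open import Data.Fin.Subset.Properties using (_∈?_)
open import Data.Integer as ℤ using ()
import Data.Integer.Properties as ℤ
open import Data.List as List using (List; []; _∷_; _++_; length; filter; allFin; cartesianProduct)
import Data.List.Properties as List
open import Data.List.Membership.Propositional using (_∈_; find)
open import Data.List.Membership.Propositional.Properties
  using (∈-allFin; ∈-map⁺; ∈-filter⁺; ∈-filter⁻; ∈-cartesianProduct⁺)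
open import Data.List.Relation.Unary.All as All using (All; []; _∷_)
import Data.List.Relation.Unary.All.Properties as All
open import Data.List.Relation.Unary.Any using (here; there; any?)
open import Data.Maybe using (Maybe; just; nothing)
import Data.Maybe.Properties as Maybe
open import Data.Nat
  using (ℕ; zero; suc; _+_; _*_; _∸_; _^_; _/_; _%_; _≤_; _<_; _>_; _≮_; _<ᵇ_; z≤n; s≤s; NonZero;
      >-nonZero; >-nonZero⁻¹)
open import Data.Nat.DivMod using (m≡m%n+[m/n]*n; m%n<n; /-monoˡ-≤)
open import Data.Nat.Divisibility using (_∣_; quotient)
open import Data.Nat.Induction using (<-wellFounded)
open import Data.Nat.ListAction using (product)
open import Data.Nat.ListAction.Properties using (∈⇒∣product; product≢0)
open import Data.Nat.Properties
open import Data.Nat.Tactic.RingSolver using (solve-∀)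
open import Data.Product using (Σ-syntax; ∃-syntax; ∃₂; _×_; _,_; proj₁; proj₂)
open import Data.Rational as ℚ using (ℚ; 1ℚ; ½)
import Data.Rational.Properties as ℚ
open import Data.Rational.Unnormalised using (mkℚᵘ; *<*; *≤*)
import Data.Rational.Unnormalised.Properties as ℚᵘ
open import Data.Sum as Sum using (_⊎_; inj₁; inj₂)
open import Data.Sum.Properties using (inj₁-injective; inj₂-injective)
open import Data.Unit using (tt)
open import Data.Vec using ([]; _∷_; lookup; tabulate)
open import Data.Vec.Properties using ([]=⇒lookup; lookup⇒[]=; lookup∘tabulate)
open import Function using (_∘_; flip; const; id)
open import Function.Definitions using (Injective)
open import Induction.WellFounded using (Acc; acc)
open import Level using (0ℓ)
open import Relation.Binary using (Rel; Symmetric; DecTotalOrder)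
open import Relation.Binary.Construct.Closure.ReflexiveTransitive using (Star; ε; _◅_; _◅◅_; reverse)
open import Relation.Binary.PropositionalEquality
open import Relation.Nullary using (¬_; Dec; yes; no; does; contradiction)
open import Relation.Nullary.Decidable using (_×-dec_; _⊎-dec_; ¬?; dec-true; dec-false; toWitness)
open import Relation.Unary using (Decidable)
open import Algebra.Properties.CommutativeSemigroup *-commutativeSemigroup using (x∙yz≈y∙xz; xy∙z≈xz∙y)
open import Algebra.Properties.Semiring.Sum +-*-semiring
  using (sum; ∑-comm; ∑-distrib-+; *-distribˡ-sum; *-distribʳ-sum; sum-cong-≗)
open import Data.List.Extrema ≤-totalOrder using (argmax; f[xs]≤f[argmax])
import Data.List.Extrema (DecTotalOrder.totalOrder ℚ.≤-decTotalOrder) as Extrema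

-- Linear inequalities and finite sums.

-- Replaces linear arithmetic: L ≤ R implies A ≤ B as soon as B + L exceeds A + R
-- by some k ≥ 0, and the latter is a semiring identity.
≤-from : ∀ {L R} A B k → L ≤ R → A + R + k ≡ B + L → A ≤ B
≤-from {L} {R} A B k L≤R eq = +-cancelʳ-≤ L A B (begin
  A + L      ≤⟨ +-monoʳ-≤ A L≤R ⟩
  A + R      ≤⟨ m≤m+n (A + R) k ⟩
  A + R + k  ≡⟨ eq ⟩
  B + L      ∎)
  where open ≤-Reasoning

∑-mono : ∀ {n} {f g : Fin n → ℕ} → (∀ i → f i ≤ g i) → sum f ≤ sum g
∑-mono {zero}  f≤g = z≤n
∑-mono {suc n} f≤g = +-mono-≤ (f≤g zero) (∑-mono (f≤g ∘ suc))

∑-<⇒∃ : ∀ {n} {f g : Fin n → ℕ} → sum f < sum g → ∃[ i ] f i < g i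
∑-<⇒∃ {f = f} {g} lt with Fin.any? (λ i → f i <? g i)
... | yes p = p
... | no ¬p = contradiction lt (≤⇒≯ (∑-mono λ i → ≮⇒≥ λ i< → ¬p (i , i<)))

∑-≤ : ∀ {n} (f : Fin n → ℕ) i → f i ≤ sum f
∑-≤ f zero    = m≤m+n _ _
∑-≤ f (suc i) = ≤-trans (∑-≤ (f ∘ suc) i) (m≤n+m _ (f zero))

∑-zero : ∀ {n} {f : Fin n → ℕ} → (∀ i → f i ≡ 0) → sum f ≡ 0
∑-zero {zero}  f≡0 = refl
∑-zero {suc n} f≡0 = cong₂ _+_ (f≡0 zero) (∑-zero (f≡0 ∘ suc))

-- Boolean predicates and their weighted measure.

⟦_⟧ : Bool → ℕ
⟦ true  ⟧ = 1
⟦ false ⟧ = 0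

⟦∧⟧ : ∀ x y → ⟦ x ∧ y ⟧ ≡ ⟦ x ⟧ * ⟦ y ⟧
⟦∧⟧ true  y = sym (+-identityʳ ⟦ y ⟧)
⟦∧⟧ false y = refl

⟦∧⟧+⟦∨⟧ : ∀ x y → ⟦ x ⟧ + ⟦ y ⟧ ≡ ⟦ x ∧ y ⟧ + ⟦ x ∨ y ⟧
⟦∧⟧+⟦∨⟧ true  y = +-comm 1 ⟦ y ⟧
⟦∧⟧+⟦∨⟧ false y = refl

⟦⟧-not : ∀ x → ⟦ x ⟧ + ⟦ not x ⟧ ≡ 1
⟦⟧-not true  = refl
⟦⟧-not false = refl

∧-true : ∀ {x y} → x ∧ y ≡ true → x ≡ true × y ≡ true
∧-true {true} p = refl , p

-- Finite sets are Boolean predicates, so that their measures compute.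
Pred : ℕ → Set
Pred n = Fin n → Bool

infixr 6 _∩_
infixr 5 _∪_

_∩_ _∪_ : ∀ {n} → Pred n → Pred n → Pred n
(S ∩ T) v = S v ∧ T v
(S ∪ T) v = S v ∨ T v

∁ : ∀ {n} → Pred n → Pred n
∁ S v = not (S v)

μ : ∀ {n} → (Fin n → ℕ) → Pred n → ℕ
μ w S = sum λ v → w v * ⟦ S v ⟧

infix 4 _⊑_
_⊑_ : ∀ {n} → Pred n → Pred n → Set
S ⊑ T = ∀ v → S v ≡ true → T v ≡ true

⟦⟧-mono : ∀ {x y} → (x ≡ true → y ≡ true) → ⟦ x ⟧ ≤ ⟦ y ⟧
⟦⟧-mono {true}  x⇒y rewrite x⇒y refl = ≤-refl
⟦⟧-mono {false} x⇒y = z≤n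

module _ {n} (w : Fin n → ℕ) where

  μ-mono : ∀ {S T} → S ⊑ T → μ w S ≤ μ w T
  μ-mono S⊑T = ∑-mono λ v → *-monoʳ-≤ (w v) (⟦⟧-mono (S⊑T v))

  μ-≤ : ∀ S → μ w S ≤ sum w
  μ-≤ S = ∑-mono λ v → ≤-trans (*-monoʳ-≤ (w v) (⟦⟧-mono {y = true} λ _ → refl))
      (≤-reflexive (*-identityʳ (w v)))

  μ-∪∩ : ∀ S T → μ w S + μ w T ≡ μ w (S ∩ T) + μ w (S ∪ T)
  μ-∪∩ S T = begin
    μ w S + μ w T                                   ≡⟨ ∑-distrib-+ (λ v → w v * ⟦ S v ⟧) _ ⟨
    sum (λ v → w v * ⟦ S v ⟧ + w v * ⟦ T v ⟧)             ≡⟨ sum-cong-≗ pointwise ⟩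
    sum (λ v → w v * ⟦ (S ∩ T) v ⟧ + w v * ⟦ (S ∪ T) v ⟧) ≡⟨ ∑-distrib-+ (λ v → w v * ⟦ (S ∩ T) v ⟧) _ ⟩
    μ w (S ∩ T) + μ w (S ∪ T)                       ∎
    where
    open ≡-Reasoning
    pointwise : ∀ v → w v * ⟦ S v ⟧ + w v * ⟦ T v ⟧ ≡ w v * ⟦ (S ∩ T) v ⟧ + w v * ⟦ (S ∪ T) v ⟧
    pointwise v = begin
      w v * ⟦ S v ⟧ + w v * ⟦ T v ⟧              ≡⟨ *-distribˡ-+ (w v) _ _ ⟨
      w v * (⟦ S v ⟧ + ⟦ T v ⟧)                  ≡⟨ cong (w v *_) (⟦∧⟧+⟦∨⟧ (S v) (T v)) ⟩
      w v * (⟦ (S ∩ T) v ⟧ + ⟦ (S ∪ T) v ⟧)      ≡⟨ *-distribˡ-+ (w v) _ _ ⟩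
      w v * ⟦ (S ∩ T) v ⟧ + w v * ⟦ (S ∪ T) v ⟧  ∎

  μ-∁ : ∀ S → μ w S + μ w (∁ S) ≡ sum w
  μ-∁ S = begin
    μ w S + μ w (∁ S)                            ≡⟨ ∑-distrib-+ (λ v → w v * ⟦ S v ⟧) _ ⟨
    sum (λ v → w v * ⟦ S v ⟧ + w v * ⟦ ∁ S v ⟧)
      ≡⟨ sum-cong-≗ (λ v → trans (sym (*-distribˡ-+ (w v) _ _))
                                                     (trans (cong (w v *_) (⟦⟧-not (S v)))
                                                         (*-identityʳ (w v)))) ⟩
    sum w                                        ∎
    where open ≡-Reasoning

  μ-∩-≥ : ∀ S T → μ w S + μ w T ≤ μ w (S ∩ T) + sum w
  μ-∩-≥ S T = begin
    μ w S + μ w T              ≡⟨ μ-∪∩ S T ⟩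
    μ w (S ∩ T) + μ w (S ∪ T)  ≤⟨ +-monoʳ-≤ (μ w (S ∩ T)) (μ-≤ (S ∪ T)) ⟩
    μ w (S ∩ T) + sum w        ∎
    where open ≤-Reasoning

  μ-witness : ∀ {S} → 0 < μ w S → ∃[ v ] S v ≡ true
  μ-witness {S} 0<μ with Fin.any? (λ v → S v ≟ᵇ true)
  ... | yes p = p
  ... | no ¬p = contradiction 0<μ (≤⇒≯ (≤-reflexive (∑-zero λ v →
    trans (cong (λ s → w v * ⟦ s ⟧) (¬-not λ t → ¬p (v , t))) (*-zeroʳ (w v)))))

  μ-restrict : ∀ S T → μ (λ v → w v * ⟦ S v ⟧) T ≡ μ w (T ∩ S)
  μ-restrict S T = sum-cong-≗ λ v → begin
    w v * ⟦ S v ⟧ * ⟦ T v ⟧    ≡⟨ *-assoc (w v) _ _ ⟩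
    w v * (⟦ S v ⟧ * ⟦ T v ⟧)  ≡⟨ cong (w v *_) (*-comm ⟦ S v ⟧ _) ⟩
    w v * (⟦ T v ⟧ * ⟦ S v ⟧)  ≡⟨ cong (w v *_) (⟦∧⟧ (T v) (S v)) ⟨
    w v * ⟦ (T ∩ S) v ⟧        ∎
    where open ≡-Reasoning

-- Parts of a vertex set and avoidance of parts already used.

∑-point : ∀ {n} (f : Fin n → ℕ) i → sum (λ j → f j * ⟦ does (i Fin.≟ j) ⟧) ≡ f i
∑-point f zero    = trans (cong₂ _+_ (*-identityʳ (f zero)) (∑-zero λ j → *-zeroʳ (f (suc j))))
    (+-identityʳ _)
∑-point f (suc i) = cong₂ _+_ (*-zeroʳ (f zero)) (∑-point (f ∘ suc) i)

module _ {n r} (p : Fin n → Fin r) where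

  at : Fin r → Pred n
  at j v = does (p v Fin.≟ j)

  off : Fin r → Pred n
  off j = ∁ (at j)

  fresh : List (Fin n) → Pred n
  fresh []      v = true
  fresh (x ∷ L) v = off (p x) v ∧ fresh L v

  Fresh : List (Fin n) → Fin n → Set
  Fresh L v = All (λ x → p v ≢ p x) L

  off-true : ∀ {j v} → off j v ≡ true → p v ≢ j
  off-true {j} {v} t eq with p v Fin.≟ j
  ... | yes _ = contradiction t λ ()
  ... | no ¬e = ¬e eq

  fresh⇒Fresh : ∀ L {v} → fresh L v ≡ true → Fresh L v
  fresh⇒Fresh []      t = []
  fresh⇒Fresh (x ∷ L) {v} t = off-true {v = v} (proj₁ (∧-true t)) ∷ fresh⇒Fresh L (proj₂ (∧-true t))

  module _ (w : Fin n → ℕ) where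

    μ-off : ∀ S j → μ w S ≤ μ w (S ∩ off j) + μ w (at j)
    μ-off S j = begin
      μ w S                              ≤⟨ ∑-mono pointwise ⟩
      sum (λ v → w v * ⟦ (S ∩ off j) v ⟧ + w v * ⟦ at j v ⟧)
        ≡⟨ ∑-distrib-+ (λ v → w v * ⟦ (S ∩ off j) v ⟧) _ ⟩
      μ w (S ∩ off j) + μ w (at j)       ∎
      where
      open ≤-Reasoning
      bool : ∀ s a → ⟦ s ⟧ ≤ ⟦ s ∧ not a ⟧ + ⟦ a ⟧
      bool true  true  = ≤-refl
      bool true  false = ≤-refl
      bool false a     = z≤n
      pointwise : ∀ v → w v * ⟦ S v ⟧ ≤ w v * ⟦ (S ∩ off j) v ⟧ + w v * ⟦ at j v ⟧
      pointwise v = ≤-trans (*-monoʳ-≤ (w v) (bool (S v) (at j v)))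
          (≤-reflexive (*-distribˡ-+ (w v) _ _))

    -- Each vertex of `L` rules out one part, at a cost of at most `N`.
    μ-fresh : ∀ {N} → (∀ j → μ w (at j) ≤ N) → ∀ S L → μ w S ≤ μ w (S ∩ fresh L) + length L * N
    μ-fresh {N} mass S []      = ≤-trans (μ-mono w {S} {S ∩ fresh []} λ v t → cong (_∧ true) t)
        (m≤m+n _ 0)
    μ-fresh {N} mass S (x ∷ L) = begin
      μ w S                                                      ≤⟨ μ-off S (p x) ⟩
      μ w (S ∩ off (p x)) + μ w (at (p x))
        ≤⟨ +-mono-≤ (μ-fresh mass (S ∩ off (p x)) L) (mass (p x)) ⟩
      μ w ((S ∩ off (p x)) ∩ fresh L) + length L * N + N
        ≤⟨ +-monoˡ-≤ N (+-monoˡ-≤ (length L * N) (μ-mono w {(S ∩ off (p x)) ∩ fresh L}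
            {S ∩ fresh (x ∷ L)}
             λ v → trans (sym (∧-assoc (S v) (off (p x) v) _)))) ⟩
      μ w (S ∩ fresh (x ∷ L)) + length L * N + N                 ≡⟨ +-assoc _ (length L * N) N ⟩
      μ w (S ∩ fresh (x ∷ L)) + (length L * N + N)
        ≡⟨ cong (μ w (S ∩ fresh (x ∷ L)) +_) (+-comm (length L * N) N) ⟩
      μ w (S ∩ fresh (x ∷ L)) + length (x ∷ L) * N               ∎
      where
      open ≤-Reasoning

    ∑-fibres : ∀ (β : Fin r → ℕ) → sum (λ v → w v * β (p v)) ≡ sum (λ j → β j * μ w (at j))
    ∑-fibres β = begin
      sum (λ v → w v * β (p v))
        ≡⟨ sum-cong-≗ (λ v → cong (w v *_) (sym (∑-point β (p v)))) ⟩
      sum (λ v → w v * sum (λ j → β j * ⟦ at j v ⟧))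
        ≡⟨ sum-cong-≗ (λ v → *-distribˡ-sum (w v) λ j → β j * ⟦ at j v ⟧) ⟩
      sum (λ v → sum (λ j → w v * (β j * ⟦ at j v ⟧)))
        ≡⟨ ∑-comm (λ v j → w v * (β j * ⟦ at j v ⟧)) ⟩
      sum (λ j → sum (λ v → w v * (β j * ⟦ at j v ⟧)))
        ≡⟨ sum-cong-≗ (λ j → trans (sum-cong-≗ λ v → x∙yz≈y∙xz (w v) (β j) ⟦ at j v ⟧)
                                   (sym (*-distribˡ-sum (β j) λ v → w v * ⟦ at j v ⟧))) ⟩
      sum (λ j → β j * μ w (at j))  ∎
      where
      open ≡-Reasoning

-- Clusters in a bipartite relation.

-- A connected set of vertices in distinct parts, built by adding neighbours.
data Cluster {a b r} (E : Fin a → Fin b → Bool) (pA : Fin a → Fin r) (pB : Fin b → Fin r) :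
             List (Fin a) → List (Fin b) → Set where
  rootA : ∀ u → Cluster E pA pB (u ∷ []) []
  rootB : ∀ v → Cluster E pA pB [] (v ∷ [])
  addA  : ∀ {LA LB u v} → Cluster E pA pB LA LB →
          Fresh pA LA u → v ∈ LB → E u v ≡ true → Cluster E pA pB (u ∷ LA) LB
  addB  : ∀ {LA LB u v} → Cluster E pA pB LA LB →
          Fresh pB LB v → u ∈ LA → E u v ≡ true → Cluster E pA pB LA (v ∷ LB)

swap : ∀ {a b r} {E : Fin a → Fin b → Bool} {pA : Fin a → Fin r} {pB : Fin b → Fin r} {LA LB} →
       Cluster E pA pB LA LB → Cluster (flip E) pB pA LB LA
swap (rootA u)        = rootB u
swap (rootB v)        = rootA v
swap (addA c f v∈ e)  = addB (swap c) f v∈ e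
swap (addB c f u∈ e)  = addA (swap c) f u∈ e

Covers : ∀ {n r} → (Fin n → Fin r) → List (Fin n) → Set
Covers p L = ∀ i → ∃[ u ] u ∈ L × p u ≡ i

-- Counting parts; the number of greedy rounds.

count : ∀ {r} → Pred r → ℕ
count M = sum λ i → ⟦ M i ⟧

count-≤ : ∀ {r} (M : Pred r) → count M ≤ r
count-≤ {zero}  M = z≤n
count-≤ {suc r} M = +-mono-≤ (⟦⟧-mono {M zero} {true} λ _ → refl) (count-≤ (M ∘ suc))

-- Abstracting k keeps the type checker from unfolding the powers to unary numerals.
decide-growth : ∀ k → T ((10 * k + 90) * 9 ^ k <ᵇ 10 ^ k) → (10 * k + 90) * 9 ^ k < 10 ^ k
decide-growth k = <ᵇ⇒< _ _

-- With `x = 10 * k + 90`, a step from `k` to `k + 1` multiplies the left side by `9 (x + 10) / x`,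
-- which is at most 10 because `90 ≤ x`, and the right side by 10. The base case `k = 200` is
-- evaluated.
growth : ∀ d → (10 * (d + 200) + 90) * 9 ^ (d + 200) < 10 ^ (d + 200)
growth zero    = decide-growth 200 tt
growth (suc d) = begin-strict
  (10 * suc k + 90) * (9 * p)  ≡⟨ cong (λ y → (y + 90) * (9 * p)) (*-suc 10 k) ⟩
  (10 + x) * (9 * p)           ≤⟨ ≤-from _ _ 0 (*-monoˡ-≤ p (m≤n+m 90 (10 * k))) (identity 9 x p) ⟩
  10 * (x * p)                 <⟨ *-monoʳ-< 10 (growth d) ⟩
  10 * 10 ^ k                  ∎
  where
  open ≤-Reasoning
  k = d + 200
  p = 9 ^ k
  x = 10 * k + 90
  identity : ∀ n x p → (1 + n + x) * (n * p) + x * p + 0 ≡ (1 + n) * (x * p) + (1 + n) * n * p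
  identity = solve-∀

-- By the first bound, a core of at most 8 vertices and `k` further ones exclude at most a tenth of
-- the weight. By the second, `k` rounds that each leave at most 9/10 of the unreached parts exhaust
-- `q + 1` parts.
greedy-length : ∀ q → 7000 ≤ q → ∃[ k ] 10 * (8 + k) ≤ q × suc q * 9 ^ k < 10 ^ k
greedy-length q 7000≤q = k , 10*[8+k]≤q , (begin-strict
  suc q * 9 ^ k          ≤⟨ *-monoˡ-≤ (9 ^ k) sucq≤ ⟩
  (10 * k + 90) * 9 ^ k
    <⟨ subst (λ k → (10 * k + 90) * 9 ^ k < 10 ^ k) (m∸n+n≡m 200≤k) (growth (k ∸ 200)) ⟩
  10 ^ k                 ∎)
  where
  open ≤-Reasoning
  Q = q / 10
  k = Q ∸ 8
  q≡ : q ≡ q % 10 + Q * 10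
  q≡ = m≡m%n+[m/n]*n q 10
  208≤Q : 208 ≤ Q
  208≤Q = ≤-trans (m≤m+n 208 492) (/-monoˡ-≤ 10 7000≤q)
  200≤k : 200 ≤ k
  200≤k = ∸-monoˡ-≤ 8 208≤Q
  8+k≡Q : 8 + k ≡ Q
  8+k≡Q = m+[n∸m]≡n (≤-trans (m≤m+n 8 200) 208≤Q)
  10*[8+k]≤q : 10 * (8 + k) ≤ q
  10*[8+k]≤q = begin
    10 * (8 + k)     ≡⟨ cong (10 *_) 8+k≡Q ⟩
    10 * Q           ≡⟨ *-comm 10 Q ⟩
    Q * 10           ≤⟨ m≤n+m _ _ ⟩
    q % 10 + Q * 10  ≡⟨ q≡ ⟨
    q                ∎
  identity : ∀ k → 10 + (8 + k) * 10 ≡ 10 * k + 90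
  identity = solve-∀
  sucq≤ : suc q ≤ 10 * k + 90
  sucq≤ = begin
    suc q                  ≡⟨ cong suc q≡ ⟩
    suc (q % 10) + Q * 10  ≤⟨ +-monoˡ-≤ (Q * 10) (m%n<n q 10) ⟩
    10 + Q * 10            ≡⟨ cong (λ x → 10 + x * 10) {x = 8 + k} 8+k≡Q ⟨
    10 + (8 + k) * 10      ≡⟨ identity k ⟩
    10 * k + 90            ∎

-- Of an overlap `x` of at least a fifth of `q * N`, the `l` excluded parts take at most a tenth of
-- `q * N`.
overlap-≤ : ∀ q N l x y → q * N ≤ 5 * x → x ≤ y + l * N → 10 * l ≤ q → q * N ≤ 10 * y
overlap-≤ q N l x y h₁ h₂ h₃ = ≤-from (q * N) (10 * y) 0
  (+-mono-≤ (+-mono-≤ (*-monoʳ-≤ 2 h₁) (*-monoʳ-≤ 10 h₂)) (*-monoˡ-≤ N h₃)) (identity q N l x y)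
  where
  identity : ∀ q N l x y → q * N + (2 * (5 * x) + 10 * (y + l * N) + q * N) + 0 ≡
                           10 * y + (2 * (q * N) + 10 * x + 10 * l * N)
  identity = solve-∀

shrink-≤ : ∀ m h → h + m ≤ 10 * h → 10 * m ≤ 9 * (h + m)
shrink-≤ m h le = ≤-from (10 * m) (9 * (h + m)) 0 le (identity m h)
  where
  identity : ∀ m h → 10 * m + 10 * h + 0 ≡ 9 * (h + m) + (h + m)
  identity = solve-∀

-- Passes the invariant of `greedy` from exponent `suc k` to `k`, with `p = 9 ^ k` and `P = 10 ^ k`.
shrink-< : ∀ m t p P → 10 * m ≤ 9 * t → t * (9 * p) < 10 * P → m * p < P
shrink-< m t p P h₁ h₂ = *-cancelˡ-< 10 (m * p) P (begin-strict
  10 * (m * p)  ≡⟨ *-assoc 10 m p ⟨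
  10 * m * p    ≤⟨ *-monoˡ-≤ p h₁ ⟩
  9 * t * p     ≡⟨ identity t p ⟩
  t * (9 * p)   <⟨ h₂ ⟩
  10 * P        ∎)
  where
  open ≤-Reasoning
  identity : ∀ t p → 9 * t * p ≡ t * (9 * p)
  identity = solve-∀

-- The greedy choice of common neighbours.

module _ {a b r} {E : Fin a → Fin b → Bool} {pA : Fin a → Fin r} {pB : Fin b → Fin r} where

  -- `LB` need not grow: one of its vertices may serve many parts. Parts already met are skipped,
  -- which keeps the parts of `LA′` distinct.
  attach : (γ : Fin r → Fin a) → (∀ i → pA (γ i) ≡ i) → ∀ {LA LB} → Cluster E pA pB LA LB →
           (∀ i → Fresh pA LA (γ i) → ∃[ v ] v ∈ LB × E (γ i) v ≡ true) →
           ∃[ LA′ ] Cluster E pA pB LA′ LB × (∀ {u} → u ∈ LA → u ∈ LA′) × Covers pA LA′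
  attach γ pγ {LA} {LB} c hit with go (allFin r)
    where
    go : ∀ is → ∃[ LA′ ] Cluster E pA pB LA′ LB × (∀ {u} → u ∈ LA → u ∈ LA′) ×
                All (λ i → ∃[ u ] u ∈ LA′ × pA u ≡ i) is
    go []       = LA , c , (λ u∈ → u∈) , []
    go (i ∷ is) with go is
    ... | LA′ , c′ , LA⊆ , cov with any? (λ u → pA (γ i) Fin.≟ pA u) LA′
    ...   | yes p with u , u∈ , eq ← find p = LA′ , c′ , LA⊆ , (u , u∈ , trans (sym eq) (pγ i)) ∷ cov
    ...   | no ¬p with fr ← All.¬Any⇒All¬ LA′ ¬p with v , v∈ , e ← hit i
            (All.tabulate (All.lookup fr ∘ LA⊆)) =
      γ i ∷ LA′ , addA c′ fr v∈ e , there ∘ LA⊆ , (γ i , here refl , pγ i) ∷ All.map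
          (λ (u , u∈ , eq) → u , there u∈ , eq) cov
  ... | LA′ , c′ , LA⊆ , cov = LA′ , c′ , LA⊆ , λ i → All.lookup cov (∈-allFin i)

  module Greedy (q N : ℕ) (0<Q : 0 < q * N) (w : Fin b → ℕ) (total : sum w ≡ q * N)
                (mass : ∀ j → μ w (at pB j) ≤ N)
                (Y : Pred b) (γ : Fin r → Fin a) where

    private
      Q = q * N

    Overlaps : Fin r → Set
    Overlaps i = Q ≤ 5 * μ w (Y ∩ E (γ i))

    hits : Pred r → Fin b → Pred r
    hits M v i = M i ∧ E (γ i) v

    double-count : ∀ M V → sum (λ v → w v * ⟦ V v ⟧ * count (hits M v)) ≡
                           sum (λ i → ⟦ M i ⟧ * μ w (V ∩ E (γ i)))
    double-count M V = begin
      sum (λ v → w v * ⟦ V v ⟧ * count (hits M v))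
        ≡⟨ sum-cong-≗ (λ v → *-distribˡ-sum (w v * ⟦ V v ⟧) λ i → ⟦ hits M v i ⟧) ⟩
      sum (λ v → sum (λ i → w v * ⟦ V v ⟧ * ⟦ hits M v i ⟧))
        ≡⟨ ∑-comm (λ v i → w v * ⟦ V v ⟧ * ⟦ hits M v i ⟧) ⟩
      sum (λ i → sum (λ v → w v * ⟦ V v ⟧ * ⟦ hits M v i ⟧))
        ≡⟨ sum-cong-≗ (λ i → sum-cong-≗ λ v → pointwise (w v) (V v) (M i) (E (γ i) v)) ⟩
      sum (λ i → sum (λ v → ⟦ M i ⟧ * (w v * ⟦ (V ∩ E (γ i)) v ⟧)))
        ≡⟨ sum-cong-≗ (λ i → *-distribˡ-sum ⟦ M i ⟧ λ v → w v * ⟦ (V ∩ E (γ i)) v ⟧) ⟨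
      sum (λ i → ⟦ M i ⟧ * μ w (V ∩ E (γ i)))  ∎
      where
      open ≡-Reasoning
      rearrange : ∀ w x m e → w * x * (m * e) ≡ m * (w * (x * e))
      rearrange = solve-∀
      pointwise : ∀ w x m e → w * ⟦ x ⟧ * ⟦ m ∧ e ⟧ ≡ ⟦ m ⟧ * (w * ⟦ x ∧ e ⟧)
      pointwise w x m e rewrite ⟦∧⟧ m e | ⟦∧⟧ x e = rearrange w ⟦ x ⟧ ⟦ m ⟧ ⟦ e ⟧

    -- Averaging. The vertices of `LB` exclude at most a tenth of the weight, so each `γ i` with `i`
    -- in `M` still sees mass `Q / 10` among the fresh vertices of `Y`. If each of these were
    -- adjacent to fewer than a tenth of the `γ i`, the double count would come out too small.
    step : ∀ LB M → (∀ i → M i ≡ true → Overlaps i) → 10 * length LB ≤ q → 0 < count M →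
           ∃[ v ] Y v ≡ true × Fresh pB LB v × count M ≤ 10 * count (hits M v)
    step LB M overlaps short 0<M with Fin.any? (λ v → (V v ≟ᵇ true) ×-dec
        (count M ≤? 10 * count (hits M v)))
      where
      V : Pred b
      V = Y ∩ fresh pB LB
    ... | yes (v , Vv , le) = v , proj₁ (∧-true Vv) , fresh⇒Fresh pB LB (proj₂ (∧-true Vv)) , le
    ... | no none = contradiction 0<Q (≤⇒≯ (+-cancelˡ-≤ (count M * Q) Q 0 (begin
      count M * Q + Q                                        ≤⟨ +-monoˡ-≤ Q below ⟩
      10 * sum (λ v → w v * ⟦ V v ⟧ * count (hits M v)) + Q  ≤⟨ above ⟩
      count M * Q                                            ≡⟨ +-identityʳ _ ⟨
      count M * Q + 0                                        ∎)))
      where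
      open ≤-Reasoning
      V : Pred b
      V = Y ∩ fresh pB LB
      c : Fin b → ℕ
      c v = count (hits M v)

      plenty : ∀ i → M i ≡ true → Q ≤ 10 * μ w (V ∩ E (γ i))
      plenty i Mi = overlap-≤ q N (length LB) (μ w (Y ∩ E (γ i))) (μ w (V ∩ E (γ i))) (overlaps i Mi)
        (≤-trans (μ-fresh pB w mass (Y ∩ E (γ i)) LB)
                 (+-monoˡ-≤ (length LB * N) (μ-mono w {(Y ∩ E (γ i)) ∩ fresh pB LB} {V ∩ E (γ i)} λ v →
                     reorder (Y v) (E (γ i) v) (fresh pB LB v))))
        short
        where
        reorder : ∀ y e f → (y ∧ e) ∧ f ≡ true → (y ∧ f) ∧ e ≡ true
        reorder true true true t = t

      below : count M * Q ≤ 10 * sum (λ v → w v * ⟦ V v ⟧ * c v)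
      below = begin
        count M * Q                                       ≡⟨ *-distribʳ-sum Q (λ i → ⟦ M i ⟧) ⟩
        sum (λ i → ⟦ M i ⟧ * Q)                           ≤⟨ ∑-mono perPart ⟩
        sum (λ i → 10 * (⟦ M i ⟧ * μ w (V ∩ E (γ i))))
          ≡⟨ *-distribˡ-sum 10 (λ i → ⟦ M i ⟧ * μ w (V ∩ E (γ i))) ⟨
        10 * sum (λ i → ⟦ M i ⟧ * μ w (V ∩ E (γ i)))      ≡⟨ cong (10 *_) (double-count M V) ⟨
        10 * sum (λ v → w v * ⟦ V v ⟧ * c v)              ∎
        where
        perPart : ∀ i → ⟦ M i ⟧ * Q ≤ 10 * (⟦ M i ⟧ * μ w (V ∩ E (γ i)))
        perPart i with M i in eq
        ... | false = z≤n
        ... | true  = begin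
          Q + 0                             ≡⟨ +-identityʳ Q ⟩
          Q                                 ≤⟨ plenty i eq ⟩
          10 * μ w (V ∩ E (γ i))            ≡⟨ cong (10 *_) (+-identityʳ (μ w (V ∩ E (γ i)))) ⟨
          10 * (μ w (V ∩ E (γ i)) + 0)      ∎

      -- The term `Q` records strictness: `10 * c v < count M` means `1 + 10 * c v ≤ count M`, and
      -- the ones add up to the total weight.
      above : 10 * sum (λ v → w v * ⟦ V v ⟧ * c v) + Q ≤ count M * Q
      above = begin
        10 * sum (λ v → w v * ⟦ V v ⟧ * c v) + Q
          ≡⟨ cong₂ _+_ (*-distribˡ-sum 10 λ v → w v * ⟦ V v ⟧ * c v) (sym total) ⟩
        sum (λ v → 10 * (w v * ⟦ V v ⟧ * c v)) + sum w
          ≡⟨ ∑-distrib-+ (λ v → 10 * (w v * ⟦ V v ⟧ * c v)) w ⟨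
        sum (λ v → 10 * (w v * ⟦ V v ⟧ * c v) + w v)               ≤⟨ ∑-mono perVertex ⟩
        sum (λ v → count M * w v)                                  ≡⟨ *-distribˡ-sum (count M) w ⟨
        count M * sum w                                            ≡⟨ cong (count M *_) total ⟩
        count M * Q                                                ∎
        where
        collect : ∀ w c → 10 * (w * 1 * c) + w ≡ (1 + 10 * c) * w
        collect = solve-∀
        perVertex : ∀ v → 10 * (w v * ⟦ V v ⟧ * c v) + w v ≤ count M * w v
        perVertex v with V v in eq
        ... | true = begin
          10 * (w v * 1 * c v) + w v  ≡⟨ collect (w v) (c v) ⟩
          suc (10 * c v) * w v        ≤⟨ *-monoˡ-≤ (w v) (≰⇒> λ le → none (v , eq , le)) ⟩
          count M * w v               ∎
        ... | false = begin
          10 * (w v * 0 * c v) + w v  ≡⟨ cong (λ x → 10 * (x * c v) + w v) (*-zeroʳ (w v)) ⟩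
          w v                         ≡⟨ *-identityˡ (w v) ⟨
          1 * w v                     ≤⟨ *-monoˡ-≤ (w v) 0<M ⟩
          count M * w v               ∎

    Reached : List (Fin a) → List (Fin b) → Pred r → Set
    Reached LA LB M = ∃[ LB′ ] Cluster E pA pB LA LB′ × (∀ {v} → v ∈ LB → v ∈ LB′) ×
      (∀ i → M i ≡ true → ∃[ v ] v ∈ LB′ × E (γ i) v ≡ true)

    module _ {LA} (hub : ∀ v → Y v ≡ true → ∃[ u ] u ∈ LA × E u v ≡ true) where

      nothing-left : ∀ {LB} M → Cluster E pA pB LA LB → count M ≡ 0 → Reached LA LB M
      nothing-left {LB} M c #M≡0 = LB , c , (λ v∈ → v∈) , λ i Mi → contradiction
        (subst₂ _≤_ (cong ⟦_⟧ Mi) #M≡0 (∑-≤ (λ i → ⟦ M i ⟧) i)) λ ()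

      rest : Pred r → Fin b → Pred r
      rest M v i = M i ∧ not (E (γ i) v)

      extend : ∀ {LB} M v → Reached LA (v ∷ LB) (rest M v) → Reached LA LB M
      extend M v (LB′ , c , LB⊆ , hit) = LB′ , c , LB⊆ ∘ there , done
        where
        done : ∀ i → M i ≡ true → ∃[ v′ ] v′ ∈ LB′ × E (γ i) v′ ≡ true
        done i Mi with E (γ i) v in eq
        ... | true  = v , LB⊆ (here refl) , eq
        ... | false = hit i (cong₂ _∧_ Mi (cong not eq))

      count-rest : ∀ M v → count M ≡ count (hits M v) + count (rest M v)
      count-rest M v = trans (sum-cong-≗ λ i → bool (M i) (E (γ i) v))
          (∑-distrib-+ (λ i → ⟦ hits M v i ⟧) λ i → ⟦ rest M v i ⟧)
        where
        bool : ∀ m e → ⟦ m ⟧ ≡ ⟦ m ∧ e ⟧ + ⟦ m ∧ not e ⟧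
        bool true true   = refl
        bool true false  = refl
        bool false e     = refl

      -- Each round adds one vertex found by `step`, tied to `LA` by `hub`, and leaves at most 9/10
      -- of `M`. At `k = 0` the invariant forces `count M` to be 0.
      greedy : ∀ k {LB} M → Cluster E pA pB LA LB → (∀ i → M i ≡ true → Overlaps i) →
               10 * (length LB + k) ≤ q → count M * 9 ^ k < 10 ^ k → Reached LA LB M
      greedy zero M c overlaps short small =
        nothing-left M c (n<1⇒n≡0 (subst (_< 1) (*-identityʳ (count M)) small))
      greedy (suc k) {LB} M c overlaps short small with count M ≟ 0
      ... | yes #M≡0 = nothing-left M c #M≡0
      ... | no  #M≢0 with step LB M overlaps (≤-trans (*-monoʳ-≤ 10 (m≤m+n (length LB) (suc k))) short)
              (n≢0⇒n>0 #M≢0)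
      ...   | v , Yv , fr , many with hub v Yv
      ...     | u , u∈ , uv = extend M v (greedy k (rest M v) (addB c fr u∈ uv)
              (λ i → overlaps i ∘ proj₁ ∘ ∧-true)
        (subst (λ l → 10 * l ≤ q) (+-suc (length LB) k) short)
        (shrink-< (count (rest M v)) (count M) (9 ^ k) (10 ^ k)
          (subst (λ t → 10 * count (rest M v) ≤ 9 * t) (sym (count-rest M v))
            (shrink-≤ (count (rest M v)) (count (hits M v))
                (subst (_≤ 10 * count (hits M v)) (count-rest M v) many)))
          small))

Fresh⇒fresh : ∀ {n r} (p : Fin n → Fin r) L {v} → Fresh p L v → fresh p L v ≡ true
Fresh⇒fresh p []      []       = refl
Fresh⇒fresh p (x ∷ L) {v} (≢ ∷ f) with p v Fin.≟ p x
... | yes eq = contradiction eq ≢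
... | no  _  = Fresh⇒fresh p L f

-- Normalised weights and edge counts.

-- Meant for `q + 1` parts of mass `N` of which one has had its weight deleted; hence the total
-- `q * N` and only an upper bound for each part.
record Normalised (q N : ℕ) {n r} (p : Fin n → Fin r) (w : Fin n → ℕ) : Set where
  field
    total : sum w ≡ q * N
    mass  : ∀ j → μ w (at p j) ≤ N

Spanning : ∀ {a b r} (E : Fin a → Fin b → Bool) (pA : Fin a → Fin r) (pB : Fin b → Fin r) → Set
Spanning E pA pB = ∃₂ λ LA LB → Cluster E pA pB LA LB × Covers pA LA × Covers pB LB

∑-edges-comm : ∀ {a b} (wA : Fin a → ℕ) (wB : Fin b → ℕ) (E : Fin a → Fin b → Bool) →
               sum (λ u → wA u * μ wB (E u)) ≡ sum (λ v → wB v * μ wA (flip E v))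
∑-edges-comm wA wB E = begin
  sum (λ u → wA u * μ wB (E u))
    ≡⟨ sum-cong-≗ (λ u → *-distribˡ-sum (wA u) λ v → wB v * ⟦ E u v ⟧) ⟩
  sum (λ u → sum λ v → wA u * (wB v * ⟦ E u v ⟧))    ≡⟨ ∑-comm (λ u v → wA u * (wB v * ⟦ E u v ⟧)) ⟩
  sum (λ v → sum λ u → wA u * (wB v * ⟦ E u v ⟧))
    ≡⟨ sum-cong-≗ (λ v → sum-cong-≗ λ u → x∙yz≈y∙xz (wA u) (wB v) ⟦ E u v ⟧) ⟩
  sum (λ v → sum λ u → wB v * (wA u * ⟦ E u v ⟧))
    ≡⟨ sum-cong-≗ (λ v → *-distribˡ-sum (wB v) λ u → wA u * ⟦ E u v ⟧) ⟨
  sum (λ v → wB v * μ wA (flip E v))                 ∎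
  where
  open ≡-Reasoning

-- If no edge joins X to Y then vertices of X only see the complement of Y, so there are
-- at most μ X * μ (∁ Y) + μ (∁ X) * S edges.
edge-between : ∀ {a b} (wA : Fin a → ℕ) (wB : Fin b → ℕ) (E : Fin a → Fin b → Bool)
               (X : Pred a) (Y : Pred b) {D S} →
               (∀ u → μ wB (E u) ≤ S) → D < 2 * sum (λ u → wA u * μ wB (E u)) →
               2 * (μ wA X * μ wB (∁ Y) + μ wA (∁ X) * S) ≤ D →
               ∃₂ λ u v → X u ≡ true × Y v ≡ true × E u v ≡ true
edge-between wA wB E X Y {D} {S} deg≤S dense small
  with Fin.any? (λ u → Fin.any? λ v → (X u ≟ᵇ true) ×-dec (Y v ≟ᵇ true) ×-dec (E u v ≟ᵇ true))
... | yes p = p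
... | no ¬p = contradiction dense (≤⇒≯ (begin
  2 * sum (λ u → wA u * μ wB (E u))
    ≤⟨ *-monoʳ-≤ 2 (∑-mono perVertex) ⟩
  2 * sum (λ u → wA u * ⟦ X u ⟧ * m + wA u * ⟦ ∁ X u ⟧ * S)
    ≡⟨ cong (2 *_) (∑-distrib-+ (λ u → wA u * ⟦ X u ⟧ * m) λ u → wA u * ⟦ ∁ X u ⟧ * S) ⟩
  2 * (sum (λ u → wA u * ⟦ X u ⟧ * m) + sum (λ u → wA u * ⟦ ∁ X u ⟧ * S))
    ≡⟨ cong₂ (λ x y → 2 * (x + y)) (*-distribʳ-sum m λ u → wA u * ⟦ X u ⟧)
        (*-distribʳ-sum S λ u → wA u * ⟦ ∁ X u ⟧) ⟨
  2 * (μ wA X * m + μ wA (∁ X) * S)                                         ≤⟨ small ⟩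
  D                                                                         ∎))
  where
  open ≤-Reasoning
  m = μ wB (∁ Y)
  avoids : ∀ u → X u ≡ true → E u ⊑ ∁ Y
  avoids u Xu v Euv with Y v in Yv
  ... | true  = contradiction (u , v , Xu , Yv , Euv) ¬p
  ... | false = refl
  perVertex : ∀ u → wA u * μ wB (E u) ≤ wA u * ⟦ X u ⟧ * m + wA u * ⟦ ∁ X u ⟧ * S
  perVertex u with X u in Xu
  ... | true  = begin
    wA u * μ wB (E u)          ≤⟨ *-monoʳ-≤ (wA u) (μ-mono wB (avoids u Xu)) ⟩
    wA u * m                   ≡⟨ cong (_* m) (*-identityʳ (wA u)) ⟨
    wA u * 1 * m               ≤⟨ m≤m+n _ _ ⟩
    wA u * 1 * m + wA u * 0 * S ∎
  ... | false = begin
    wA u * μ wB (E u)          ≤⟨ *-monoʳ-≤ (wA u) (deg≤S u) ⟩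
    wA u * S                   ≡⟨ cong (_* S) (*-identityʳ (wA u)) ⟨
    wA u * 1 * S               ≤⟨ m≤n+m _ _ ⟩
    wA u * 0 * m + wA u * 1 * S ∎

-- Inequalities for the linking steps.

-- After `σ` is replaced by `m`, the right side exceeds the left by `(a - b) * (m - c)`, and both
-- factors are positive. Here `a`, `b` and `m`, `c` are the masses of a set and its complement on
-- either side.
exact-bound : ∀ Q a b m c σ → a + b ≡ Q → m + c ≡ Q → Q < 2 * a → Q < 2 * m → σ ≤ m →
              2 * (a * c + b * σ) ≤ Q * Q
exact-bound Q a b m c σ refl m+c≡ Q<2a Q<2m σ≤m = begin
  2 * (a * c + b * σ)  ≤⟨ *-monoʳ-≤ 2 (+-monoʳ-≤ (a * c) (*-monoʳ-≤ b σ≤m)) ⟩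
  2 * (a * c + b * m)
    ≤⟨ ≤-from _ _ (d * f) (≤-refl {0}) (trans (cong₂ (λ a m → 2 * (a * c + b * m) + 0 + d * f)
        (sym b+d≡a) (sym c+f≡m)) (trans (identity b c d f)
            (cong₂ (λ a m → (a + b) * (m + c) + 0) b+d≡a c+f≡m))) ⟩
  (a + b) * (m + c)    ≡⟨ cong ((a + b) *_) m+c≡ ⟩
  (a + b) * (a + b)    ∎
  where
  open ≤-Reasoning
  half : ∀ x y → x + y < 2 * x → y ≤ x
  half x y lt = <⇒≤ (+-cancelˡ-< x y x (subst (x + y <_) (cong (x +_) (+-identityʳ x)) lt))
  d = a ∸ b
  f = m ∸ c
  b+d≡a : b + d ≡ a
  b+d≡a = m+[n∸m]≡n (half a b Q<2a)
  c+f≡m : c + f ≡ m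
  c+f≡m = m+[n∸m]≡n (half m c (subst (_< 2 * m) (sym m+c≡) Q<2m))
  identity : ∀ b c d f → 2 * ((b + d) * c + b * (c + f)) + 0 + d * f ≡ (b + d + b) * (c + f + c) + 0
  identity = solve-∀

-- Writing `σ = c + f` turns `a * c + b * σ` into `Q * c + b * f`, where `b` is at most `6Q / 10`.
-- Twice this is at most `Q * ((c + σ) + 2f / 10)`; finally `c + σ` is at most `8Q / 10` and `f` at
-- most `Q`.
robust-bound₁ : ∀ Q a b m c σ → a + b ≡ Q → m + c ≡ Q → Q < 2 * σ → 10 * σ + 2 * Q ≤ 10 * m →
    4 * Q ≤ 10 * a →
                2 * (a * c + b * σ) ≤ Q * Q
robust-bound₁ Q a b m c σ a+b≡ m+c≡ Q<2σ m-large a-large = *-cancelˡ-≤ 10 (begin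
  10 * (2 * (a * c + b * σ))          ≡⟨ cong (λ σ → 10 * (2 * (a * c + b * σ))) c+f≡σ ⟨
  10 * (2 * (a * c + b * (c + f)))    ≡⟨ i₁ a b c f ⟩
  20 * ((a + b) * c) + 2 * (10 * b * f)
    ≤⟨ +-mono-≤ (≤-reflexive (cong (λ x → 20 * (x * c)) a+b≡)) (*-monoʳ-≤ 2 (*-monoˡ-≤ f 10b≤6Q)) ⟩
  20 * (Q * c) + 2 * (6 * Q * f)      ≡⟨ i₂ Q c f ⟩
  Q * (10 * (c + (c + f)) + 2 * f)    ≤⟨ *-monoʳ-≤ Q (+-mono-≤ 10[c+σ]≤8Q (*-monoʳ-≤ 2 f≤Q)) ⟩
  Q * (8 * Q + 2 * Q)                 ≡⟨ i₃ Q ⟩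
  10 * (Q * Q)                        ∎)
  where
  open ≤-Reasoning
  i₁ : ∀ a b c f → 10 * (2 * (a * c + b * (c + f))) ≡ 20 * ((a + b) * c) + 2 * (10 * b * f)
  i₁ = solve-∀
  i₂ : ∀ Q c f → 20 * (Q * c) + 2 * (6 * Q * f) ≡ Q * (10 * (c + (c + f)) + 2 * f)
  i₂ = solve-∀
  i₃ : ∀ Q → Q * (8 * Q + 2 * Q) ≡ 10 * (Q * Q)
  i₃ = solve-∀
  10b≤6Q : 10 * b ≤ 6 * Q
  10b≤6Q = subst (λ Q → 10 * b ≤ 6 * Q) a+b≡ (≤-from _ _ 0
      (subst (λ Q → 4 * Q ≤ 10 * a) (sym a+b≡) a-large) (i₄ a b))
    where
    i₄ : ∀ a b → 10 * b + 10 * a + 0 ≡ 6 * (a + b) + 4 * (a + b)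
    i₄ = solve-∀
  10[σ+c]≤8Q : 10 * (σ + c) ≤ 8 * Q
  10[σ+c]≤8Q = subst (λ Q → 10 * (σ + c) ≤ 8 * Q) m+c≡ (≤-from _ _ 0
      (subst (λ Q → 10 * σ + 2 * Q ≤ 10 * m) (sym m+c≡) m-large) (i₅ m c σ))
    where
    i₅ : ∀ m c σ → 10 * (σ + c) + 10 * m + 0 ≡ 8 * (m + c) + (10 * σ + 2 * (m + c))
    i₅ = solve-∀
  c≤σ : c ≤ σ
  c≤σ = *-cancelˡ-≤ 10 (≤-from (10 * c) (10 * σ) (2 * Q) (+-mono-≤ 10[σ+c]≤8Q
      (*-monoʳ-≤ 10 (<⇒≤ Q<2σ))) (i₆ Q c σ))
    where
    i₆ : ∀ Q c σ → 10 * c + (8 * Q + 10 * (2 * σ)) + 2 * Q ≡ 10 * σ + (10 * (σ + c) + 10 * Q)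
    i₆ = solve-∀
  f = σ ∸ c
  c+f≡σ : c + f ≡ σ
  c+f≡σ = m+[n∸m]≡n c≤σ
  10[c+σ]≤8Q : 10 * (c + (c + f)) ≤ 8 * Q
  10[c+σ]≤8Q = subst (_≤ 8 * Q) (cong (10 *_) (trans (+-comm σ c) (cong (c +_) (sym c+f≡σ)))) 10[σ+c]≤8Q
  f≤Q : f ≤ Q
  f≤Q = begin
    f      ≤⟨ m≤n+m f c ⟩
    c + f  ≡⟨ c+f≡σ ⟩
    σ      ≤⟨ *-cancelˡ-≤ 10 (≤-trans (m≤m+n (10 * σ) (2 * Q)) m-large) ⟩
    m      ≤⟨ m≤m+n m c ⟩
    m + c  ≡⟨ m+c≡ ⟩
    Q      ∎

am-gm : ∀ x y → 4 * (x * y) ≤ (x + y) * (x + y)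
am-gm x y with ≤-total x y
... | inj₁ x≤y = subst (λ y → 4 * (x * y) ≤ (x + y) * (x + y)) (m+[n∸m]≡n x≤y)
        (≤-from _ _ _ (≤-refl {0}) (identity x (y ∸ x)))
  where
  identity : ∀ x d → 4 * (x * (x + d)) + 0 + d * d ≡ (x + (x + d)) * (x + (x + d)) + 0
  identity = solve-∀
... | inj₂ y≤x = subst (λ x → 4 * (x * y) ≤ (x + y) * (x + y)) (m+[n∸m]≡n y≤x)
        (≤-from _ _ _ (≤-refl {0}) (identity y (x ∸ y)))
  where
  identity : ∀ y d → 4 * ((y + d) * y) + 0 + d * d ≡ (y + d + y) * (y + d + y) + 0
  identity = solve-∀

-- The shares are m b ≤ 0.21 Q², c m ≤ 0.25 Q² and c (7 N) ≤ 0.01 Q².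
robust-bound₂ : ∀ Q N b m c σ → m + c ≡ Q → 700 * N ≤ Q → σ ≤ m + 6 * N → 100 * b ≤ 21 * Q →
                2 * (m * b + c * (σ + N)) ≤ Q * Q
robust-bound₂ Q N b m c σ m+c≡ 700N≤Q σ≤ b-small = *-cancelˡ-≤ 100 (begin
  100 * (2 * (m * b + c * (σ + N)))
    ≤⟨ *-monoʳ-≤ 100 (*-monoʳ-≤ 2 (+-monoʳ-≤ (m * b) (*-monoʳ-≤ c (+-monoˡ-≤ N σ≤)))) ⟩
  100 * (2 * (m * b + c * (m + 6 * N + N)))           ≡⟨ i₁ m b c N ⟩
  2 * (m * (100 * b)) + 50 * (4 * (m * c)) + 2 * (c * (700 * N))
    ≤⟨ +-mono-≤ (+-mono-≤ (*-monoʳ-≤ 2 (*-mono-≤ m≤Q b-small))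
        (*-monoʳ-≤ 50 (subst (λ Q → 4 * (m * c) ≤ Q * Q) m+c≡ (am-gm m c))))
            (*-monoʳ-≤ 2 (*-mono-≤ c≤Q 700N≤Q)) ⟩
  2 * (Q * (21 * Q)) + 50 * (Q * Q) + 2 * (Q * Q)     ≡⟨ i₂ Q ⟩
  94 * (Q * Q)                                        ≤⟨ *-monoˡ-≤ (Q * Q) (m≤m+n 94 6) ⟩
  100 * (Q * Q)                                       ∎)
  where
  open ≤-Reasoning
  i₁ : ∀ m b c N → 100 * (2 * (m * b + c * (m + 6 * N + N))) ≡ 2 * (m * (100 * b)) + 50 *
      (4 * (m * c)) + 2 * (c * (700 * N))
  i₁ = solve-∀
  i₂ : ∀ Q → 2 * (Q * (21 * Q)) + 50 * (Q * Q) + 2 * (Q * Q) ≡ 94 * (Q * Q)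
  i₂ = solve-∀
  m≤Q : m ≤ Q
  m≤Q = subst (m ≤_) m+c≡ (m≤m+n m c)
  c≤Q : c ≤ Q
  c≤Q = subst (c ≤_) m+c≡ (m≤n+m c m)

common-> : ∀ Q s t z → Q < 2 * s → Q < 2 * t → s + t ≤ z + Q → 0 < z
common-> Q s t z h₁ h₂ h₃ = *-cancelˡ-≤ 2 (≤-from 2 (2 * z) 0
    (+-mono-≤ (+-mono-≤ h₁ h₂) (*-monoʳ-≤ 2 h₃)) (identity Q s t z))
  where
  identity : ∀ Q s t z → 2 + (2 * s + 2 * t + 2 * (z + Q)) + 0 ≡ 2 * z + (1 + Q + (1 + Q) + 2 * (s + t))
  identity = solve-∀

-- For good neighbourhoods of masses `s`, `t`, `x`, the first two with intersection `o` and union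
-- `u`: `u` exceeds `Q / 2 + Q / 2 - Q / 5 = 4Q / 5`, so the union shares more than `3Q / 10` with
-- the third.
union-overlap-≤ : ∀ Q s t x o u z → Q < 2 * s → Q < 2 * t → Q < 2 * x → 5 * o < Q →
                  s + t ≤ o + u → u + x ≤ z + Q → Q ≤ 5 * z
union-overlap-≤ Q s t x o u z h₁ h₂ h₃ h₄ h₅ h₆ = *-cancelˡ-≤ 2 (≤-from (2 * Q) (2 * (5 * z)) Q
  (+-mono-≤ (+-mono-≤ (+-mono-≤ (*-monoʳ-≤ 5 (+-mono-≤ (+-mono-≤ (<⇒≤ h₁) (<⇒≤ h₂)) (<⇒≤ h₃)))
      (*-monoʳ-≤ 2 (<⇒≤ h₄)))
    (*-monoʳ-≤ 10 h₅)) (*-monoʳ-≤ 10 h₆)) (identity Q s t x o u z))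
  where
  identity : ∀ Q s t x o u z →
    2 * Q + (5 * (2 * s + 2 * t + 2 * x) + 2 * Q + 10 * (o + u) + 10 * (z + Q)) + Q ≡
    2 * (5 * z) + (5 * (Q + Q + Q) + 2 * (5 * o) + 10 * (s + t) + 10 * (u + x))
  identity = solve-∀

-- The gain of the union over `s` is at least `t - o`, which exceeds `Q / 2 - Q / 5`.
union-≤ : ∀ Q s t o u → Q < 2 * t → 5 * o < Q → s + t ≤ o + u → 10 * s + 3 * Q ≤ 10 * u
union-≤ Q s t o u h₁ h₂ h₃ = ≤-from (10 * s + 3 * Q) (10 * u) 0
  (+-mono-≤ (+-mono-≤ (*-monoʳ-≤ 5 (<⇒≤ h₁)) (*-monoʳ-≤ 2 (<⇒≤ h₂))) (*-monoʳ-≤ 10 h₃))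
      (identity Q s t o u)
  where
  identity : ∀ Q s t o u → 10 * s + 3 * Q + (5 * (2 * t) + 2 * Q + 10 * (o + u)) + 0 ≡
                           10 * u + (5 * Q + 2 * (5 * o) + 10 * (s + t))
  identity = solve-∀

-- With e the mass of the excluded parts.
fresh-large-≤ : ∀ Q c k x y e → c + suc k * Q ≤ 10 * x → x ≤ y + e → 10 * e ≤ Q → c + k * Q ≤ 10 * y
fresh-large-≤ Q c k x y e h₁ h₂ h₃ = ≤-from (c + k * Q) (10 * y) 0
  (+-mono-≤ (+-mono-≤ h₁ (*-monoʳ-≤ 10 h₂)) h₃) (identity Q c k x y e)
  where
  identity : ∀ Q c k x y e → c + k * Q + (10 * x + 10 * (y + e) + Q) + 0 ≡
                             10 * y + (c + (1 + k) * Q + 10 * x + 10 * e)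
  identity = solve-∀

-- The union `u` exceeds `4Q / 5` and the excluded parts take at most `Q / 100` of it, so less than
-- `21Q / 100` lies outside what is left.
complement-small-≤ : ∀ Q s t o u a b e → Q < 2 * s → Q < 2 * t → 5 * o < Q → s + t ≤ o + u →
                     u ≤ a + e → 100 * e ≤ Q → a + b ≡ Q → 100 * b ≤ 21 * Q
complement-small-≤ Q s t o u a b e h₁ h₂ h₃ h₄ h₅ h₆ refl = ≤-from (100 * b) (21 * (a + b)) 0
  (+-mono-≤ (+-mono-≤ (+-mono-≤ (+-mono-≤ (*-monoʳ-≤ 50 (+-mono-≤ (<⇒≤ h₁) (<⇒≤ h₂)))
      (*-monoʳ-≤ 20 (<⇒≤ h₃)))
    (*-monoʳ-≤ 100 h₄)) (*-monoʳ-≤ 100 h₅)) h₆) (identity s t o u a b e)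
  where
  identity : ∀ s t o u a b e →
    100 * b + (50 * (2 * s + 2 * t) + 20 * (a + b) + 100 * (o + u) + 100 * (a + e) + (a + b)) + 0 ≡
    21 * (a + b) + (50 * (a + b + (a + b)) + 20 * (5 * o) + 100 * (s + t) + 100 * u + 100 * e)
  identity = solve-∀

-- Common neighbours and hubs on one side.

-- Two sets of more than half the weight overlap in positive mass, and the part `j`, having mass 0,
-- can be left out for free.
common-neighbour : ∀ {n r} (p : Fin n → Fin r) (w : Fin n → ℕ) S T j → μ w (at p j) ≡ 0 →
                   sum w < 2 * μ w S → sum w < 2 * μ w T → ∃[ v ] S v ≡ true × T v ≡ true × p v ≢ j
common-neighbour p w S T j null S-good T-good =
  let v , t = μ-witness w (common-> (sum w) (μ w S) (μ w T) (μ w U) S-good T-good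
          (≤-trans (μ-∩-≥ w S T) (+-monoˡ-≤ (sum w) ≤U)))
      st , v-off = ∧-true {(S ∩ T) v} t
  in v , proj₁ (∧-true {S v} st) , proj₂ (∧-true {S v} st) , off-true p {v = v} v-off
  where
  U = (S ∩ T) ∩ off p j
  ≤U : μ w (S ∩ T) ≤ μ w U
  ≤U = subst (μ w (S ∩ T) ≤_) (trans (cong (μ w U +_) null) (+-identityʳ (μ w U))) (μ-off p w (S ∩ T) j)

union-hub : ∀ {b} {S T : Pred b} {v} → (S ∪ T) v ≡ true → S v ≡ true ⊎ T v ≡ true
union-hub {S = S} {v = v} t with S v
... | true  = inj₁ refl
... | false = inj₂ t

module Side {a b r} (q N : ℕ) (r≤ : r ≤ suc q) (7000≤q : 7000 ≤ q) (0<N : 0 < N)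
            (E : Fin a → Fin b → Bool) (pA : Fin a → Fin r) (pB : Fin b → Fin r)
            (wB : Fin b → ℕ) (normB : Normalised q N pB wB)
            (γ : Fin r → Fin a) (good : ∀ i → q * N < 2 * μ wB (E (γ i))) where

  open Normalised normB

  Q : ℕ
  Q = q * N

  0<Q : 0 < Q
  0<Q = *-mono-≤ (≤-trans (m≤m+n 1 6999) 7000≤q) 0<N

  Close : Pred b → Fin a → Set
  Close Y x = Q ≤ 5 * μ wB (Y ∩ E x)

  module G (Y : Pred b) = Greedy {E = E} {pA} {pB} q N 0<Q wB total mass Y γ

  Neighbours : Pred b → List (Fin a) → Set
  Neighbours Y LA = ∀ v → Y v ≡ true → ∃[ u ] u ∈ LA × E u v ≡ true

  neighbours : ∀ {u LA} → u ∈ LA → Neighbours (E u) LA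
  neighbours u∈ v e = _ , u∈ , e

  neighbours-∪ : ∀ {u u′ LA} → u ∈ LA → u′ ∈ LA → Neighbours (E u ∪ E u′) LA
  neighbours-∪ {u} {u′} u∈ u′∈ v e with union-hub {S = E u} {T = E u′} {v} e
  ... | inj₁ e₁ = u , u∈ , e₁
  ... | inj₂ e₂ = u′ , u′∈ , e₂

  separate? : ∀ x LA → (∃[ i ] Fresh pA LA (γ i) × 5 * μ wB (E x ∩ E (γ i)) < Q) ⊎
                       (∀ i → Fresh pA LA (γ i) → Close (E x) (γ i))
  separate? x LA with Fin.any? (λ i → All.all? (λ x′ → ¬? (pA (γ i) Fin.≟ pA x′)) LA ×-dec
      (5 * μ wB (E x ∩ E (γ i)) <? Q))
  ... | yes p = inj₁ p
  ... | no ¬p = inj₂ λ i f → ≮⇒≥ λ lt → ¬p (i , f , lt)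

  close-∪ : ∀ x x′ → Q < 2 * μ wB (E x) → Q < 2 * μ wB (E x′) → 5 * μ wB (E x ∩ E x′) < Q →
            ∀ i → Close (E x ∪ E x′) (γ i)
  close-∪ x x′ gx gx′ far i = union-overlap-≤ Q (μ wB (E x)) (μ wB (E x′)) (μ wB (E (γ i)))
      (μ wB (E x ∩ E x′)) (μ wB (E x ∪ E x′)) (μ wB ((E x ∪ E x′) ∩ E (γ i)))
    gx gx′ (good i) far (≤-reflexive (μ-∪∩ wB (E x) (E x′)))
    (subst (λ t → μ wB (E x ∪ E x′) + μ wB (E (γ i)) ≤ μ wB ((E x ∪ E x′) ∩ E (γ i)) + t) total
        (μ-∩-≥ wB (E x ∪ E x′) (E (γ i))))

  Reached : List (Fin a) → List (Fin b) → Set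
  Reached LA LB = ∃[ LB′ ] Cluster E pA pB LA LB′ × (∀ {v} → v ∈ LB → v ∈ LB′) ×
    (∀ i → Fresh pA LA (γ i) → ∃[ v ] v ∈ LB′ × E (γ i) v ≡ true)

  -- The 8 is the room for the core reserved by `greedy-length`; parts already met by `LA` are not
  -- among those to be reached.
  reach : ∀ {LA LB} → Cluster E pA pB LA LB → length LB ≤ 8 → ∀ Y → Neighbours Y LA →
          (∀ i → Fresh pA LA (γ i) → Close Y (γ i)) → Reached LA LB
  reach {LA} {LB} c short Y nb close = steps (greedy-length q 7000≤q)
    where
    M = fresh pA LA ∘ γ
    steps : ∃[ k ] 10 * (8 + k) ≤ q × suc q * 9 ^ k < 10 ^ k → Reached LA LB
    steps (k , k-short , k-long) =
      let LB′ , c′ , LB⊆ , hit = G.greedy Y nb k M c (λ i → close i ∘ fresh⇒Fresh pA LA)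
            (≤-trans (*-monoʳ-≤ 10 (+-monoˡ-≤ k short)) k-short)
            (≤-<-trans (*-monoˡ-≤ (9 ^ k) (≤-trans (count-≤ M) r≤)) k-long)
      in LB′ , c′ , LB⊆ , λ i → hit i ∘ Fresh⇒fresh pA LA

  -- The parts of `l` vertices take at most the share `1 / k` of the total weight.
  excluded-mass : ∀ k l → l * k ≤ 7000 → k * (l * N) ≤ Q
  excluded-mass k l le = begin
    k * (l * N)  ≡⟨ *-assoc k l N ⟨
    k * l * N    ≤⟨ *-monoˡ-≤ N (≤-trans (≤-trans (≤-reflexive (*-comm k l)) le) 7000≤q) ⟩
    Q            ∎
    where open ≤-Reasoning

-- The connected core.

-- `wA` vanishes on the part of `g` and `wB` on that of `y`. Vertices can be kept out of these two
-- parts at no loss of mass, as `link` requires. Degrees of the two sides are compared before the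
-- deletion, and the `+ N` in `max′` pays for it.
module Core {a b r} (q N : ℕ) (r≤ : r ≤ suc q) (7000≤q : 7000 ≤ q) (0<N : 0 < N)
            (E : Fin a → Fin b → Bool) (pA : Fin a → Fin r) (pB : Fin b → Fin r)
            (wA : Fin a → ℕ) (wB : Fin b → ℕ)
            (normA : Normalised q N pA wA) (normB : Normalised q N pB wB)
            (dense : q * N * (q * N) < 2 * sum (λ u → wA u * μ wB (E u)))
            (γ : Fin r → Fin a) (pγ : ∀ i → pA (γ i) ≡ i) (γ-good : ∀ i → q * N < 2 * μ wB (E (γ i)))
            (η : Fin r → Fin b) (pη : ∀ j → pB (η j) ≡ j)
            (η-good : ∀ j → q * N < 2 * μ wA (flip E (η j)))
            (g : Fin a) (max : ∀ u → μ wB (E u) ≤ μ wB (E g))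
            (max′ : ∀ v → μ wA (flip E v) ≤ μ wB (E g) + N)
            (y : Fin b) (y-good : q * N < 2 * μ wA (flip E y))
            (g-null : μ wA (at pA (pA g)) ≡ 0) (y-null : μ wB (at pB (pB y)) ≡ 0) (i₀ : Fin r) where

  private
    module A = Side q N r≤ 7000≤q 0<N E pA pB wB normB γ γ-good
    module B = Side q N r≤ 7000≤q 0<N (flip E) pB pA wA normA η η-good
    module NA = Normalised normA
    module NB = Normalised normB
    Q = q * N
    σ = μ wB (E g)

  g-good : Q < 2 * σ
  g-good = <-≤-trans (γ-good i₀) (*-monoʳ-≤ 2 (max (γ i₀)))

  -- The greedy choice runs once per side, enlarging `LB` for the `γ i` and then `LA` for the `η j`;
  -- the hub property of `X` survives because `LB` only grows. The `γ i` and `η j` themselves are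
  -- attached last, to neighbours that are present by then.
  finish : ∀ {LA LB} → Cluster E pA pB LA LB → length LA ≤ 8 → length LB ≤ 8 →
           ∀ Y → A.Neighbours Y LA → (∀ i → Fresh pA LA (γ i) → A.Close Y (γ i)) →
           ∀ X → B.Neighbours X LB → (∀ j → Fresh pB LB (η j) → B.Close X (η j)) →
           Spanning E pA pB
  finish {LA} {LB} c sA sB Y nY cY X nX cX =
    let LB′ , c₁ , LB⊆ , hitA = A.reach c sB Y nY cY
        -- The first run leaves `LA` unchanged, so the bound on its length still applies.
        LA′ , c₂ , LA⊆ , hitB = B.reach (swap c₁) sA X
          (λ u t → let v , v∈ , e = nX u t in v , LB⊆ v∈ , e)
          (λ j f → cX j (All.tabulate (All.lookup f ∘ LB⊆)))
        LA″ , c₃ , LA⊆′ , covA = attach γ pγ (swap c₂) (λ i f → hitA i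
            (All.tabulate (All.lookup f ∘ LA⊆)))
        LB″ , c₄ , _ , covB = attach η pη (swap c₃) (λ j f → let u , u∈ , e = hitB j f in
              u , LA⊆′ u∈ , e)
    in LA″ , LB″ , swap c₄ , covA , covB

  -- The excluded parts take at most `Q / 10` on each side: `Y` keeps at least `σ + 2Q / 10` and the
  -- neighbourhood of `y′` at least `4Q / 10`, as `robust-bound₁` demands.
  join-edge : ∀ LA LB → length LA ≤ 7 → length LB ≤ 7 → ∀ Y → 10 * σ + 3 * Q ≤ 10 * μ wB Y →
              ∀ y′ → Q < 2 * μ wA (flip E y′) →
              ∃₂ λ u v → (flip E y′ ∩ fresh pA LA) u ≡ true × (Y ∩ fresh pB LB) v ≡ true × E u v ≡ true
  join-edge LA LB sA sB Y Y-large y′ y′-good = edge-between wA wB E X° Y° max dense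
    (robust-bound₁ Q (μ wA X°) (μ wA (∁ X°)) (μ wB Y°) (μ wB (∁ Y°)) σ
      (trans (μ-∁ wA X°) NA.total) (trans (μ-∁ wB Y°) NB.total) g-good
      (fresh-large-≤ Q (10 * σ) 2 (μ wB Y) (μ wB Y°) (length LB * N) Y-large
        (μ-fresh pB wB NB.mass Y LB) (A.excluded-mass 10 (length LB)
            (≤-trans (*-monoˡ-≤ 10 sB) (m≤m+n 70 6930))))
      (fresh-large-≤ Q 0 4 (μ wA (flip E y′)) (μ wA X°) (length LA * N)
        (≤-trans (*-monoʳ-≤ 5 (<⇒≤ y′-good)) (≤-reflexive (sym (*-assoc 5 2 (μ wA (flip E y′))))))
        (μ-fresh pA wA NA.mass (flip E y′) LA) (A.excluded-mass 10 (length LA)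
            (≤-trans (*-monoˡ-≤ 10 sA) (m≤m+n 70 6930)))))
    where
    X° = flip E y′ ∩ fresh pA LA
    Y° = Y ∩ fresh pB LB

  -- The vertex `y′` is reached by a path `u₀ – v – u – y′`, with `u₀` in `LA` since `v` lies in
  -- `Y`.
  join : ∀ {LA LB} → Cluster E pA pB LA LB → length LA ≤ 7 → length LB ≤ 6 →
         ∀ Y → A.Neighbours Y LA → 10 * σ + 3 * Q ≤ 10 * μ wB Y →
         ∀ y′ → Q < 2 * μ wA (flip E y′) → Fresh pB LB y′ →
         ∃₂ λ u v → Cluster E pA pB (u ∷ LA) (y′ ∷ v ∷ LB)
  join {LA} {LB} c sA sB Y nY Y-large y′ y′-good fr =
    -- `y′` counts as used already, so that `v`, which is added before it, avoids its part.
    let u , v , Xu , Yv , uv = join-edge LA (y′ ∷ LB) sA (s≤s sB) Y Y-large y′ y′-good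
        u₀ , u₀∈ , u₀v = nY v (proj₁ (∧-true Yv))
        v-fresh = fresh⇒Fresh pB (y′ ∷ LB) {v} (proj₂ (∧-true {Y v} Yv))
    in u , v , addB (addA (addB c (All.tail v-fresh) u₀∈ u₀v)
            (fresh⇒Fresh pA LA (proj₂ (∧-true {E u y′} Xu))) (here refl) uv)
                    ((All.head v-fresh ∘ sym) ∷ fr) (here refl) (proj₁ (∧-true Xu))

  -- The exact step: both σ and the degree of y exceed Q / 2, by no definite amount.
  link : ∃₂ λ u v → Cluster E pA pB (u ∷ g ∷ []) (y ∷ v ∷ [])
  link = let u , v , Xu , Yv , uv = crossing in u , v ,
    addB (addA (addB (rootA g) [] (here refl) (proj₁ (∧-true Yv)))
        (off-true pA {v = u} (proj₂ (∧-true {E u y} Xu)) ∷ []) (here refl) uv)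
         ((off-true pB {v = v} (proj₂ (∧-true {E g v} Yv)) ∘ sym) ∷ []) (here refl) (proj₁ (∧-true Xu))
    where
    X° = flip E y ∩ off pA (pA g)
    Y° = E g ∩ off pB (pB y)
    drop-null : ∀ {n} (p : Fin n → Fin r) w S x → μ w (at p (p x)) ≡ 0 → μ w S ≤ μ w (S ∩ off p (p x))
    drop-null p w S x null = subst (μ w S ≤_) (trans (cong (μ w (S ∩ off p (p x)) +_) null)
        (+-identityʳ _)) (μ-off p w S (p x))
    crossing : ∃₂ λ u v → X° u ≡ true × Y° v ≡ true × E u v ≡ true
    crossing = edge-between wA wB E X° Y° max dense
      (exact-bound Q (μ wA X°) (μ wA (∁ X°)) (μ wB Y°) (μ wB (∁ Y°)) σ
        (trans (μ-∁ wA X°) NA.total) (trans (μ-∁ wB Y°) NB.total)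
        (<-≤-trans y-good (*-monoʳ-≤ 2 (drop-null pA wA (flip E y) g g-null)))
        (<-≤-trans g-good (*-monoʳ-≤ 2 (drop-null pB wB (E g) y y-null)))
        (drop-null pB wB (E g) y y-null))

  -- The union `Y` exceeds `σ` by `3Q / 10` and is close to every `γ i`. Once `g` and `x` are joined
  -- through `v₀`, `join` links `y` to them. If the `η j` in parts not yet met are close to `y`, its
  -- neighbourhood is the second hub; otherwise a far `η j` is linked as well, and the hub is the
  -- union of the two neighbourhoods.
  far-in-A : ∀ i → Fresh pA (g ∷ []) (γ i) → 5 * μ wB (E g ∩ E (γ i)) < Q → Spanning E pA pB
  far-in-A i (≢g ∷ []) far =
    -- `v₀` avoids the part of `y`, so that `y` can still be added.
    let v₀ , gv₀ , xv₀ , v₀≢ = common-neighbour pB wB (E g) (E x) (pB y) y-null (lift σ g-good)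
            (lift (μ wB (E x)) (γ-good i))
        u₁ , v₁ , c = join (addA (addB (rootA g) [] (here refl) gv₀) (≢g ∷ []) (here refl) xv₀)
          (m≤m+n 2 5) (m≤m+n 1 5) Y (A.neighbours-∪ (there (here refl)) (here refl)) Y-large y y-good
              ((v₀≢ ∘ sym) ∷ [])
    in complete c (B.separate? y (y ∷ v₁ ∷ v₀ ∷ []))
    where
    x = γ i
    lift : ∀ s → Q < 2 * s → sum wB < 2 * s
    lift s = subst (_< 2 * s) (sym NB.total)
    Y = E g ∪ E x
    Y-large : 10 * σ + 3 * Q ≤ 10 * μ wB Y
    Y-large = union-≤ Q σ (μ wB (E x)) (μ wB (E g ∩ E x)) (μ wB Y) (γ-good i) far
        (≤-reflexive (μ-∪∩ wB (E g) (E x)))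
    Y-close : ∀ i → A.Close Y (γ i)
    Y-close = A.close-∪ g x g-good (γ-good i) far
    complete : ∀ {u₁ v₁ v₀} → Cluster E pA pB (u₁ ∷ x ∷ g ∷ []) (y ∷ v₁ ∷ v₀ ∷ []) →
               (∃[ j ] Fresh pB (y ∷ v₁ ∷ v₀ ∷ []) (η j) × 5 * μ wA (flip E y ∩ flip E (η j)) < Q) ⊎
               (∀ j → Fresh pB (y ∷ v₁ ∷ v₀ ∷ []) (η j) → B.Close (flip E y) (η j)) → Spanning E pA pB
    complete c (inj₂ close) = finish c (m≤m+n 3 5) (m≤m+n 3 5)
      Y (A.neighbours-∪ (there (there (here refl))) (there (here refl))) (λ i _ → Y-close i)
      (flip E y) (B.neighbours (here refl)) close
    complete c (inj₁ (j , fr , far′)) =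
      let u₂ , v₂ , c′ = join c (m≤m+n 3 4) (m≤m+n 3 3) Y
            (A.neighbours-∪ (there (there (here refl))) (there (here refl))) Y-large (η j) (η-good j) fr
      in finish c′ (m≤m+n 4 4) (m≤m+n 5 3)
        Y (A.neighbours-∪ (there (there (there (here refl)))) (there (there (here refl))))
            (λ i _ → Y-close i)
        (flip E y ∪ flip E (η j)) (B.neighbours-∪ (there (there (here refl))) (here refl))
        (λ j′ _ → B.close-∪ y (η j) y-good (η-good j) far′ j′)

  -- The vertices `y` and `y′` are joined through `u₀`, and the union `X` of their neighbourhoods
  -- has mass above `4Q / 5`. An edge from `X` to the neighbourhood of `g` then brings `g` into the
  -- cluster; by the hypothesis `close`, `E g` alone is a hub for the left parts.
  far-in-B : (∀ i → Fresh pA (g ∷ []) (γ i) → A.Close (E g) (γ i)) →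
             ∀ j → Fresh pB (y ∷ []) (η j) → 5 * μ wA (flip E y ∩ flip E (η j)) < Q → Spanning E pA pB
  far-in-B close j (≢y ∷ []) far =
    let u₀ , yu₀ , y′u₀ , u₀≢ = common-neighbour pA wA (flip E y) (flip E (η j)) (pA g) g-null
          (subst (_< 2 * μ wA (flip E y)) (sym NA.total) y-good)
              (subst (_< 2 * μ wA (flip E (η j))) (sym NA.total) (η-good j))
    in go u₀ yu₀ y′u₀ u₀≢
    where
    y′ = η j
    X = flip E y ∪ flip E y′
    go : ∀ u₀ → E u₀ y ≡ true → E u₀ y′ ≡ true → pA u₀ ≢ pA g → Spanning E pA pB
    go u₀ yu₀ y′u₀ u₀≢ =
      let v₁ , u₁ , Yv , Xu , uv = crossing
          y₀ , y₀∈ , u₁y₀ = B.neighbours-∪ {y} {y′} {LB} (there (here refl)) (here refl) u₁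
              (proj₁ (∧-true Xu))
          u₁-fresh = fresh⇒Fresh pA LA {u₁} (proj₂ (∧-true {X u₁} Xu))
      in finish (addA (addB (addA (addB (addA (rootB y) [] (here refl) yu₀) (≢y ∷ []) (here refl) y′u₀)
              (All.tail u₁-fresh) y₀∈ u₁y₀)
                 (fresh⇒Fresh pB LB (proj₂ (∧-true {E g v₁} Yv))) (here refl) uv)
                 ((All.head u₁-fresh ∘ sym) ∷ (u₀≢ ∘ sym) ∷ []) (here refl) (proj₁ (∧-true Yv)))
          (m≤m+n 3 5) (m≤m+n 3 5) (E g) (A.neighbours (here refl))
              (λ { i (≢g ∷ _) → close i (≢g ∷ []) })
          X (B.neighbours-∪ (there (there (here refl))) (there (here refl)))
              (λ j′ _ → B.close-∪ y y′ y-good (η-good j) far j′)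
      where
      LA = g ∷ u₀ ∷ []
      LB = y′ ∷ y ∷ []
      X° = X ∩ fresh pA LA
      Y° = E g ∩ fresh pB LB
      crossing : ∃₂ λ v u → Y° v ≡ true × X° u ≡ true × E u v ≡ true
      -- Counted from the right: without a crossing edge, vertices of `Y°` see only the small
      -- complement of `X°`, and the others have degree at most `σ + N` by `max′`.
      crossing = edge-between wB wA (flip E) Y° X° max′ (subst (λ t → Q * Q < 2 * t)
          (∑-edges-comm wA wB E) dense)
        (robust-bound₂ Q N (μ wA (∁ X°)) (μ wB Y°) (μ wB (∁ Y°)) σ (trans (μ-∁ wB Y°) NB.total)
          (subst (_≤ Q) (cong (700 *_) (*-identityˡ N)) (A.excluded-mass 700 1 (m≤m+n 700 6300)))
          (≤-trans (μ-fresh pB wB NB.mass (E g) LB) (+-monoʳ-≤ (μ wB Y°) (*-monoˡ-≤ N (m≤m+n 2 4))))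
          (complement-small-≤ Q (μ wA (flip E y)) (μ wA (flip E y′)) (μ wA (flip E y ∩ flip E y′))
              (μ wA X) (μ wA X°) (μ wA (∁ X°)) (length LA * N)
            y-good (η-good j) far (≤-reflexive (μ-∪∩ wA (flip E y) (flip E y′)))
                (μ-fresh pA wA NA.mass X LA)
            (A.excluded-mass 100 2 (m≤m+n 200 6800)) (trans (μ-∁ wA X°) NA.total)))

  spanning : Spanning E pA pB
  spanning with A.separate? g (g ∷ [])
  ... | inj₁ (i , fr , far) = far-in-A i fr far
  ... | inj₂ closeA with B.separate? y (y ∷ [])
  ...   | inj₁ (j , fr , far) = far-in-B closeA j fr far
  ...   | inj₂ closeB =
    let u , v , c = link
    in finish c (m≤m+n 2 6) (m≤m+n 2 6) (E g) (A.neighbours (there (here refl)))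
            (λ { i (_ ∷ f) → closeA i f })
      (flip E y) (B.neighbours (here refl)) (λ { j (≢y ∷ _) → closeB j (≢y ∷ []) })

-- Averaging, and deletion of one part on each side.

argmax-Fin : ∀ {n} → Fin n → (f : Fin n → ℕ) → ∃[ i ] ∀ j → f j ≤ f i
argmax-Fin {n} i₀ f = argmax f i₀ (allFin n) , λ j → All.lookup (f[xs]≤f[argmax] i₀ (allFin n))
    (∈-allFin j)

module _ {n r} (p : Fin n → Fin r) (w : Fin n → ℕ) where

  inPart outsidePart : Fin r → Fin n → ℕ
  inPart i u = w u * ⟦ at p i u ⟧
  outsidePart i u = w u * ⟦ off p i u ⟧

  outside-null : ∀ i → μ (outsidePart i) (at p i) ≡ 0
  outside-null i = ∑-zero λ u → trans (*-assoc (w u) _ _) (trans (cong (w u *_) (disjoint (at p i u)))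
      (*-zeroʳ (w u)))
    where
    disjoint : ∀ x → ⟦ not x ⟧ * ⟦ x ⟧ ≡ 0
    disjoint true  = refl
    disjoint false = refl

  outside-≤ : ∀ i S → μ (outsidePart i) S ≤ μ w S
  outside-≤ i S = ∑-mono λ u → *-monoˡ-≤ ⟦ S u ⟧ (≤-trans (*-monoʳ-≤ (w u)
      (⟦⟧-mono {off p i u} {true} λ _ → refl)) (≤-reflexive (*-identityʳ (w u))))

∑-one : ∀ {n} (j : Fin n) → sum (λ i → ⟦ does (i Fin.≟ j) ⟧) ≡ 1
∑-one {suc n} zero = cong suc (∑-zero {n} {λ _ → 0} λ _ → refl)
∑-one (suc j) = ∑-one j

∑-ones : ∀ n → sum {n} (λ _ → 1) ≡ n
∑-ones zero    = refl
∑-ones (suc n) = cong suc (∑-ones n)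

∑-others : ∀ {q} (j : Fin (suc q)) → sum (λ i → ⟦ not (does (i Fin.≟ j)) ⟧) ≡ q
∑-others {q} j = suc-injective (begin
  1 + sum (λ i → ⟦ not (does (i Fin.≟ j)) ⟧)
    ≡⟨ cong (_+ sum (λ i → ⟦ not (does (i Fin.≟ j)) ⟧)) (∑-one j) ⟨
  sum (λ i → ⟦ does (i Fin.≟ j) ⟧) + sum (λ i → ⟦ not (does (i Fin.≟ j)) ⟧)
    ≡⟨ ∑-distrib-+ (λ i → ⟦ does (i Fin.≟ j) ⟧) (λ i → ⟦ not (does (i Fin.≟ j)) ⟧) ⟨
  sum (λ i → ⟦ does (i Fin.≟ j) ⟧ + ⟦ not (does (i Fin.≟ j)) ⟧)
    ≡⟨ sum-cong-≗ (λ i → ⟦⟧-not (does (i Fin.≟ j))) ⟩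
  sum {suc q} (λ _ → 1)                                                            ≡⟨ ∑-ones (suc q) ⟩
  suc q                                                                            ∎)
  where open ≡-Reasoning

module _ {n q} (p : Fin n → Fin (suc q)) (w : Fin n → ℕ) where

  private
    β : Fin (suc q) → Fin (suc q) → ℕ
    β i₁ i = ⟦ not (does (i Fin.≟ i₁)) ⟧

  ∑-outside : ∀ (f : Fin n → ℕ) i₁ → sum (λ u → outsidePart p w i₁ u * f u) ≡
                                       sum (λ i → β i₁ i * sum (λ u → inPart p w i u * f u))
  ∑-outside f i₁ = begin
    sum (λ u → w u * β i₁ (p u) * f u)
      ≡⟨ sum-cong-≗ (λ u → xy∙z≈xz∙y (w u) (β i₁ (p u)) (f u)) ⟩
    sum (λ u → w u * f u * β i₁ (p u))
      ≡⟨ ∑-fibres p (λ u → w u * f u) (β i₁) ⟩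
    sum (λ i → β i₁ i * sum (λ u → w u * f u * ⟦ at p i u ⟧))
      ≡⟨ sum-cong-≗ (λ i → cong (β i₁ i *_) (sum-cong-≗ λ u → xy∙z≈xz∙y (w u) (f u) ⟦ at p i u ⟧)) ⟩
    sum (λ i → β i₁ i * sum (λ u → inPart p w i u * f u))           ∎
    where
    open ≡-Reasoning

  -- Strictness is carried by `suc D`, which each of the `q` other parts contributes at least.
  dense-outside : ∀ (f : Fin n → ℕ) i₁ D → 0 < q → (∀ i → D < 2 * sum (λ u → inPart p w i u * f u)) →
                  q * D < 2 * sum (λ u → outsidePart p w i₁ u * f u)
  dense-outside f i₁ D 0<q dense = begin-strict
    q * D
      <⟨ *-monoʳ-< q {{>-nonZero 0<q}} (n<1+n D) ⟩
    q * suc D                                                         ≡⟨ cong (_* suc D) (∑-others i₁) ⟨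
    sum (β i₁) * suc D                                                ≡⟨ *-distribʳ-sum (suc D) (β i₁) ⟩
    sum (λ i → β i₁ i * suc D)
      ≤⟨ ∑-mono (λ i → *-monoʳ-≤ (β i₁ i) (dense i)) ⟩
    sum (λ i → β i₁ i * (2 * sum (λ u → inPart p w i u * f u)))
      ≡⟨ sum-cong-≗ (λ i → x∙yz≈y∙xz (β i₁ i) 2 (sum λ u → inPart p w i u * f u)) ⟩
    sum (λ i → 2 * (β i₁ i * sum (λ u → inPart p w i u * f u)))
      ≡⟨ *-distribˡ-sum 2 (λ i → β i₁ i * sum (λ u → inPart p w i u * f u)) ⟨
    2 * sum (λ i → β i₁ i * sum (λ u → inPart p w i u * f u))         ≡⟨ cong (2 *_) (∑-outside f i₁) ⟨
    2 * sum (λ u → outsidePart p w i₁ u * f u)                        ∎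
    where
    open ≤-Reasoning

  outside-normalised : ∀ {N} → (∀ i → μ w (at p i) ≡ N) → ∀ i₁ → Normalised q N p (outsidePart p w i₁)
  outside-normalised {N} mass i₁ = record
    { total = begin
        sum (outsidePart p w i₁)                ≡⟨ ∑-fibres p w (β i₁) ⟩
        sum (λ i → β i₁ i * μ w (at p i))       ≡⟨ sum-cong-≗ (λ i → cong (β i₁ i *_) (mass i)) ⟩
        sum (λ i → β i₁ i * N)                  ≡⟨ *-distribʳ-sum N (β i₁) ⟨
        sum (β i₁) * N                          ≡⟨ cong (_* N) (∑-others i₁) ⟩
        q * N                                   ∎
    ; mass = λ i → ≤-trans (outside-≤ p w i₁ (at p i)) (≤-reflexive (mass i))
    }
    where open ≡-Reasoning

  -- Some term of the weighted sum must exceed its share of `N * D`; a vertex outside the part `i`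
  -- has weight 0 and cannot provide it.
  above-average : ∀ {N} i → μ w (at p i) ≡ N → ∀ (f : Fin n → ℕ) D → N * D < 2 * sum
      (λ u → inPart p w i u * f u) →
                  ∃[ u ] p u ≡ i × D < 2 * f u
  above-average {N} i mass f D dense with ∑-<⇒∃ {f = λ u → inPart p w i u * D}
      {g = λ u → inPart p w i u * (2 * f u)} (begin-strict
    sum (λ u → inPart p w i u * D)           ≡⟨ *-distribʳ-sum D (inPart p w i) ⟨
    sum (inPart p w i) * D                   ≡⟨ cong (_* D) mass ⟩
    N * D                                    <⟨ dense ⟩
    2 * sum (λ u → inPart p w i u * f u)     ≡⟨ *-distribˡ-sum 2 (λ u → inPart p w i u * f u) ⟩
    sum (λ u → 2 * (inPart p w i u * f u))   ≡⟨ sum-cong-≗ (λ u → x∙yz≈y∙xz 2 (inPart p w i u) (f u)) ⟩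
    sum (λ u → inPart p w i u * (2 * f u))   ∎)
    where
    open ≤-Reasoning
  ... | u , lt with p u Fin.≟ i
  ...   | yes pu≡i = u , pu≡i , *-cancelˡ-< (w u * 1) D (2 * f u) lt
  ...   | no  _    = contradiction lt (subst (λ z → z * D ≮ z * (2 * f u)) (sym (*-zeroʳ (w u))) λ ())

-- `N * N` is the weight of all pairs between two parts, so the field `dense` puts every density
-- above one half.
record Dense (q N : ℕ) {a b} (E : Fin a → Fin b → Bool) (pA : Fin a → Fin (suc q))
    (pB : Fin b → Fin (suc q))
             (wA : Fin a → ℕ) (wB : Fin b → ℕ) : Set where
  field
    massA : ∀ i → μ wA (at pA i) ≡ N
    massB : ∀ j → μ wB (at pB j) ≡ N
    dense : ∀ i j → N * N < 2 * sum (λ u → inPart pA wA i u * μ (inPart pB wB j) (E u))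

module _ {q N a b : ℕ} {E : Fin a → Fin b → Bool} {pA : Fin a → Fin (suc q)} {pB : Fin b → Fin (suc q)}
         {wA : Fin a → ℕ} {wB : Fin b → ℕ} where

  Dense-swap : Dense q N E pA pB wA wB → Dense q N (flip E) pB pA wB wA
  Dense-swap d = record
    { massA = massB
    ; massB = massA
    ; dense = λ j i → subst (λ t → N * N < 2 * t) (∑-edges-comm (inPart pA wA i) (inPart pB wB j) E)
        (dense i j)
    }
    where open Dense d

  dense-row : Dense q N E pA pB wA wB → 0 < q → ∀ j₁ i →
              N * (q * N) < 2 * sum (λ u → inPart pA wA i u * μ (outsidePart pB wB j₁) (E u))
  dense-row d 0<q j₁ i = subst₂ (λ x t → x < 2 * t) (x∙yz≈y∙xz q N N)
    (sym (∑-edges-comm (inPart pA wA i) (outsidePart pB wB j₁) E))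
    (dense-outside pB wB (λ v → μ (inPart pA wA i) (flip E v)) j₁ (N * N) 0<q λ j → Dense.dense
        (Dense-swap d) j i)

module _ {q N a b : ℕ} {E : Fin a → Fin b → Bool} {pA : Fin a → Fin (suc q)} {pB : Fin b → Fin (suc q)}
         {wA : Fin a → ℕ} {wB : Fin b → ℕ} (d : Dense q N E pA pB wA wB) (7000≤q : 7000 ≤ q)
             (0<N : 0 < N) where

  open Dense d

  -- The order of choices matters: the weight of `j₁` is deleted on the right, then `g` maximises
  -- the remaining degrees, then the part of `g` is deleted on the left, and only for these weights
  -- are good right vertices chosen, with `y` in the part `j₁`.
  dominant⇒spanning : (∃[ x ] ∀ v → μ wA (flip E v) ≤ μ wB (E x)) → Spanning E pA pB
  dominant⇒spanning (x , dominant) = Core.spanning q N ≤-refl 7000≤q 0<N E pA pB wA′ wB′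
    (outside-normalised pA wA massA i₁) (outside-normalised pB wB massB j₁)
    (subst (_< 2 * sum (λ u → wA′ u * s u)) (reassoc q N)
      (dense-outside pA wA s i₁ (N * (q * N)) 0<q (dense-row d 0<q j₁)))
    γ (λ i → proj₁ (proj₂ (good i))) (λ i → proj₂ (proj₂ (good i)))
    η (λ j → proj₁ (proj₂ (good′ j))) (λ j → proj₂ (proj₂ (good′ j)))
    g max max′ (η j₁) (proj₂ (proj₂ (good′ j₁))) (outside-null pA wA i₁)
    (subst (λ j → μ wB′ (at pB j) ≡ 0) (sym (proj₁ (proj₂ (good′ j₁)))) (outside-null pB wB j₁)) zero
    where
    reassoc : ∀ q N → q * (N * (q * N)) ≡ q * N * (q * N)
    reassoc = solve-∀
    0<q = ≤-trans (m≤m+n 1 6999) 7000≤q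
    j₁ : Fin (suc q)
    j₁ = zero
    wB′ = outsidePart pB wB j₁
    s = λ u → μ wB′ (E u)
    good : ∀ i → ∃[ u ] pA u ≡ i × q * N < 2 * s u
    good i = above-average pA wA i (massA i) s (q * N) (dense-row d 0<q j₁ i)
    γ = λ i → proj₁ (good i)
    maximal = argmax-Fin (γ zero) s
    g = proj₁ maximal
    max = proj₂ maximal
    i₁ = pA g
    wA′ = outsidePart pA wA i₁
    t = λ v → μ wA′ (flip E v)
    good′ : ∀ j → ∃[ v ] pB v ≡ j × q * N < 2 * t v
    good′ j = above-average pB wB j (massB j) t (q * N) (dense-row (Dense-swap d) 0<q i₁ j)
    η = λ j → proj₁ (good′ j)
    max′ : ∀ v → t v ≤ s g + N
    max′ v = begin
      t v                                            ≤⟨ outside-≤ pA wA i₁ (flip E v) ⟩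
      μ wA (flip E v)                                ≤⟨ dominant v ⟩
      μ wB (E x)                                     ≤⟨ μ-off pB wB (E x) j₁ ⟩
      μ wB (E x ∩ off pB j₁) + μ wB (at pB j₁)
        ≡⟨ cong₂ _+_ (sym (μ-restrict wB (off pB j₁) (E x))) (massB j₁) ⟩
      s x + N                                        ≤⟨ +-monoˡ-≤ N (max x) ⟩
      s g + N                                        ∎
      where open ≤-Reasoning

module _ {q N a b : ℕ} {E : Fin a → Fin b → Bool} {pA : Fin a → Fin (suc q)} {pB : Fin b → Fin (suc q)}
         {wA : Fin a → ℕ} {wB : Fin b → ℕ} where

  dense⇒spanning : Dense q N E pA pB wA wB → 7000 ≤ q → 0 < N → Fin a → Fin b → Spanning E pA pB
  dense⇒spanning d 7000≤q 0<N u₀ v₀ =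
    let x , max = argmax-Fin u₀ (λ u → μ wB (E u))
        y , max′ = argmax-Fin v₀ (λ v → μ wA (flip E v))
    in choose x max y max′ (≤-total (μ wA (flip E y)) (μ wB (E x)))
    where
    choose : ∀ x → (∀ u → μ wB (E u) ≤ μ wB (E x)) → ∀ y → (∀ v → μ wA (flip E v) ≤ μ wA (flip E y)) →
             μ wA (flip E y) ≤ μ wB (E x) ⊎ μ wB (E x) ≤ μ wA (flip E y) → Spanning E pA pB
    choose x max y max′ (inj₁ y≤x) = dominant⇒spanning d 7000≤q 0<N (x , λ v → ≤-trans (max′ v) y≤x)
    choose x max y max′ (inj₂ x≤y) =
      let LB , LA , c , covB , covA = dominant⇒spanning (Dense-swap d) 7000≤q 0<N
              (y , λ u → ≤-trans (max u) x≤y)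
      in LA , LB , swap c , covA , covB

-- Spanning trees.

least : ∀ {P : ℕ → Set} → (∀ k → Dec (P k)) → ∀ k → P k → ∃[ d ] P d × (∀ j → P j → d ≤ j)
least P? zero    p = 0 , p , λ _ _ → z≤n
least P? (suc k) p with P? 0
... | yes p₀ = 0 , p₀ , λ _ _ → z≤n
... | no ¬p₀ with d , pd , min ← least (P? ∘ suc) k p =
  suc d , pd , λ { zero p₀ → contradiction p₀ ¬p₀ ; (suc j) pj → s≤s (min j pj) }

-- At either end of the index range one neighbour comes from `close`, and `long` keeps it apart from
-- the other; elsewhere the two indices differ by 2.
two-neighbours : ∀ {n} {G : Graph n} (C : Cycle G) → let open Cycle C in
                 ∀ i → ∃₂ λ j k → j ≢ k × Adj G (c i) (c j) × Adj G (c i) (c k)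
two-neighbours {G = G} record { l = suc (suc l) ; step = step ; close = close } zero =
  suc zero , fromℕ _ , (λ ()) , step zero , symm G close
two-neighbours record { l = suc zero ; long = s≤s () }
two-neighbours {G = G} record { l = suc (suc l) ; step = step ; close = close } (suc j) with view j
... | ‵fromℕ      = inject₁ j , zero , (λ ()) , symm G (step j) , close
... | ‵inject₁ j′ = inject₁ j , suc (suc j′) , apart , symm G (step j) , step (suc j′)
  where
  apart : inject₁ (inject₁ j′) ≢ suc (suc j′)
  apart eq = <⇒≢ (m<n+m (toℕ j′) {2} (s≤s z≤n))
    (trans (sym (trans (Fin.toℕ-inject₁ (inject₁ j′)) (Fin.toℕ-inject₁ j′))) (cong toℕ eq))

-- A rooted tree given by parents. The strict decrease of `depth` makes every chain of parents end
-- at `ρ` and excludes cycles.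
module ParentTree {m} (ρ : Fin m) (depth : Fin m → ℕ) (parent : Fin m → Maybe (Fin m))
                  (orphan : ∀ {v} → parent v ≡ nothing → v ≡ ρ)
                  (shallower : ∀ {v u} → parent v ≡ just u → depth u < depth v) where

  tree : Graph m
  tree = record
    { Adj    = λ u v → parent u ≡ just v ⊎ parent v ≡ just u
    ; adj?   = λ u v → Maybe.≡-dec Fin._≟_ (parent u) (just v) ⊎-dec Maybe.≡-dec Fin._≟_ (parent v)
        (just u)
    ; symm   = Sum.swap
    ; irrefl = λ { refl (inj₁ e) → <-irrefl refl (shallower e) ; refl (inj₂ e) → <-irrefl refl
        (shallower e) }
    }

  toRoot : ∀ v → Acc _<_ (depth v) → Star (Adj tree) v ρ
  toRoot v (acc rs) with parent v in eq
  ... | nothing = subst (Star (Adj tree) v) (orphan eq) ε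
  ... | just u  = inj₁ eq ◅ toRoot u (rs (shallower eq))

  connected : Connected tree
  connected = ρ , λ u v → toRoot u (<-wellFounded _) ◅◅ reverse (symm tree) (toRoot v (<-wellFounded _))

  deepest : ∀ {u v} → Adj tree u v → depth v ≤ depth u → parent u ≡ just v
  deepest (inj₁ e) _  = e
  deepest (inj₂ e) le = contradiction (shallower e) (≤⇒≯ le)

  -- Both neighbours of a deepest vertex on a cycle would be its parent.
  acyclic : ¬ Cycle tree
  acyclic C =
    let i , deep = argmax-Fin zero (depth ∘ c)
        j , k , j≢k , ij , ik = two-neighbours C i
    in j≢k (distinct (Maybe.just-injective (trans (sym (deepest ij (deep j))) (deepest ik (deep k)))))
    where open Cycle C

  isTree : IsTree tree
  isTree = connected , acyclic

-- Breadth-first search: each vertex other than `ρ` takes as parent a neighbour at smaller distance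
-- from `ρ`. `Within k` stands for a walk to `ρ` of length at most `k`.
spanningTree : ∀ {m} (S : Graph m) (ρ : Fin m) → (∀ v → Star (Adj S) v ρ) →
               Σ[ T ∈ Graph m ] IsTree T × (∀ {u v} → Adj T u v → Adj S u v)
spanningTree {m} S ρ reachable = tree , isTree , embed
  where
  Within : ℕ → Fin m → Set
  Within zero    v = v ≡ ρ
  Within (suc k) v = Within k v ⊎ ∃[ u ] Adj S v u × Within k u

  within? : ∀ k v → Dec (Within k v)
  within? zero    v = v Fin.≟ ρ
  within? (suc k) v = within? k v ⊎-dec Fin.any? λ u → adj? S v u ×-dec within? k u

  within : ∀ {v} → Star (Adj S) v ρ → ∃[ k ] Within k v
  within ε         = 0 , refl
  within (e ◅ es) with k , w ← within es = suc k , inj₂ (_ , e , w)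

  distance : ∀ v → ∃[ d ] Within d v × (∀ j → Within j v → d ≤ j)
  distance v = let k , w = within (reachable v) in least (λ k → within? k v) k w

  depth : Fin m → ℕ
  depth v = proj₁ (distance v)

  nearer : ∀ v → v ≡ ρ ⊎ ∃[ u ] Adj S v u × depth u < depth v
  nearer v with distance v
  ... | zero  , v≡ρ , _              = inj₁ v≡ρ
  ... | suc d , inj₁ w , min         = contradiction (min d w) (<⇒≱ (n<1+n d))
  ... | suc d , inj₂ (u , e , w) , _ = inj₂ (u , e , s≤s (proj₂ (proj₂ (distance u)) d w))

  parent : Fin m → Maybe (Fin m)
  parent v = Sum.[ (λ _ → nothing) , just ∘ proj₁ ] (nearer v)

  orphan : ∀ {v} → parent v ≡ nothing → v ≡ ρ
  orphan {v} eq with nearer v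
  ... | inj₁ v≡ρ = v≡ρ

  parent-nearer : ∀ {v u} → parent v ≡ just u → Adj S v u × depth u < depth v
  parent-nearer {v} eq with nearer v
  parent-nearer refl | inj₂ (_ , p) = p

  open ParentTree ρ depth parent orphan (proj₂ ∘ parent-nearer)

  embed : ∀ {u v} → Adj tree u v → Adj S u v
  embed (inj₁ e) = proj₁ (parent-nearer e)
  embed (inj₂ e) = symm S (proj₁ (parent-nearer e))

-- Connectedness of clusters.

module _ {a b r} {E : Fin a → Fin b → Bool} {pA : Fin a → Fin r} {pB : Fin b → Fin r} where

  part-injective : ∀ {LA LB} → Cluster E pA pB LA LB → ∀ {u u′} → u ∈ LA → u′ ∈ LA → pA u ≡ pA u′ →
      u ≡ u′
  part-injective (rootA _)       (here refl) (here refl) _  = refl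
  part-injective (addA c fr _ _) (here refl) (here refl) _  = refl
  part-injective (addA c fr _ _) (here refl) (there u′∈) eq = contradiction eq (All.lookup fr u′∈)
  part-injective (addA c fr _ _) (there u∈)  (here refl) eq = contradiction (sym eq) (All.lookup fr u∈)
  part-injective (addA c fr _ _) (there u∈)  (there u′∈) eq = part-injective c u∈ u′∈ eq
  part-injective (addB c _ _ _)  u∈          u′∈         eq = part-injective c u∈ u′∈ eq

  -- An edge reveals on which side a vertex lies when `pA` and `pB` have default values. The
  -- exception, a cluster of one vertex, cannot cover both sides.
  has-edge : ∀ {LA LB} → Cluster E pA pB LA LB → ∀ {u} → u ∈ LA →
             (LA ≡ u ∷ [] × LB ≡ []) ⊎ ∃[ v ] E u v ≡ true
  has-edge (rootA _)       (here refl) = inj₁ (refl , refl)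
  has-edge (addA c _ v∈ e) (here refl) = inj₂ (_ , e)
  has-edge (addA c _ v∈ e) (there u∈) with has-edge c u∈
  ... | inj₂ p           = inj₂ p
  has-edge (addA c _ () e) (there u∈) | inj₁ (_ , refl)
  has-edge (addB c _ u₀∈ e) u∈ with has-edge c u∈
  ... | inj₂ p           = inj₂ p
  has-edge (addB c _ (here refl) e) u∈ | inj₁ (refl , _) = inj₂ (_ , e)

  cluster-connected : ∀ {V : Set} {R : Rel V 0ℓ} → Symmetric R → (f : Fin a → V) (g : Fin b → V) → ∀
      {LA LB} →
    Cluster E pA pB LA LB → (∀ {u v} → u ∈ LA → v ∈ LB → E u v ≡ true → R (f u) (g v)) →
    ∃[ ρ ] (∀ {u} → u ∈ LA → Star R (f u) ρ) × (∀ {v} → v ∈ LB → Star R (g v) ρ)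
  cluster-connected R-sym f g (rootA u) rel = f u , (λ { (here refl) → ε }) , λ ()
  cluster-connected R-sym f g (rootB v) rel = g v , (λ ()) , λ { (here refl) → ε }
  cluster-connected R-sym f g (addA c _ v∈ e) rel
    with ρ , A→ρ , B→ρ ← cluster-connected R-sym f g c (rel ∘ there) =
    ρ , (λ { (here refl) → rel (here refl) v∈ e ◅ B→ρ v∈ ; (there u∈) → A→ρ u∈ }) , B→ρ
  cluster-connected R-sym f g (addB c _ u∈ e) rel
    with ρ , A→ρ , B→ρ ← cluster-connected R-sym f g c (λ u∈ v∈ → rel u∈ (there v∈)) =
    ρ , A→ρ , λ { (here refl) → R-sym (rel u∈ (here refl) e) ◅ A→ρ u∈ ; (there v∈) → B→ρ v∈ }

-- Edge counts and densities as finite sums.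

length-filter-tabulate : ∀ {A : Set} {P : A → Set} (P? : Decidable P) {n} (f : Fin n → A) →
                         length (filter P? (List.tabulate f)) ≡ sum λ i → ⟦ does (P? (f i)) ⟧
length-filter-tabulate P? {zero}  f = refl
length-filter-tabulate P? {suc n} f with does (P? (f zero))
... | true  = cong suc (length-filter-tabulate P? (f ∘ suc))
... | false = length-filter-tabulate P? (f ∘ suc)

length-filter-product : ∀ {A B : Set} {P : A × B → Set} (P? : Decidable P) {m n} (f : Fin m → A)
    (g : Fin n → B) →
                        length (filter P? (cartesianProduct (List.tabulate f) (List.tabulate g))) ≡
                        sum λ i → sum λ j → ⟦ does (P? (f i , g j)) ⟧
length-filter-product P? {zero}  f g = refl
length-filter-product P? {suc m} f g = begin
  length (filter P? (row ++ rest))                       ≡⟨ cong length (List.filter-++ P? row rest) ⟩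
  length (filter P? row ++ filter P? rest)               ≡⟨ List.length-++ (filter P? row) ⟩
  length (filter P? row) + length (filter P? rest)
    ≡⟨ cong₂ _+_ (trans (cong (length ∘ filter P?) (List.map-tabulate g (f zero ,_)))
                                                                             (length-filter-tabulate P?
                                                                                 λ j → f zero , g j))
                                                                      (length-filter-product P?
                                                                          (f ∘ suc) g) ⟩
  sum (λ i → sum λ j → ⟦ does (P? (f i , g j)) ⟧)        ∎
  where
  open ≡-Reasoning
  row = List.map (f zero ,_) (List.tabulate g)
  rest = cartesianProduct (List.tabulate (f ∘ suc)) (List.tabulate g)

does-∈? : ∀ {n} (x : Fin n) (X : Subset n) → does (x ∈? X) ≡ lookup X x
does-∈? zero    (true  ∷ X) = refl
does-∈? zero    (false ∷ X) = refl
does-∈? (suc x) (_ ∷ X)     = does-∈? x X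

∣∣-sum : ∀ {n} (X : Subset n) → ∣ X ∣ ≡ sum λ x → ⟦ lookup X x ⟧
∣∣-sum []          = refl
∣∣-sum (true  ∷ X) = cong suc (∣∣-sum X)
∣∣-sum (false ∷ X) = ∣∣-sum X

e-sum : ∀ {n} (G : Graph n) X Y →
        e G X Y ≡ sum λ u → sum λ v → ⟦ lookup X u ∧ lookup Y v ∧ does (adj? G u v) ⟧
e-sum G X Y = trans (length-filter-product (λ (x , y) → (x ∈? X) ×-dec (y ∈? Y) ×-dec adj? G x y) id id)
  (sum-cong-≗ λ u → sum-cong-≗ λ v → cong₂ (λ x y → ⟦ x ∧ y ∧ does (adj? G u v) ⟧) (does-∈? u X)
      (does-∈? v Y))

½</⇒ : ∀ m d .{{_ : NonZero d}} → ½ ℚ.< ℤ.+ m ℚ./ d → d < 2 * m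
½</⇒ m (suc d) lt with ℚᵘ.<-respʳ-≃ (ℚ.toℚᵘ-fromℚᵘ (mkℚᵘ (ℤ.+ m) d)) (ℚ.toℚᵘ-mono-< lt)
... | *<* lt′ = subst₂ _<_ (*-identityˡ (suc d)) (*-comm m 2)
  (ℤ.drop‿+<+ (subst₂ ℤ._<_ (sym (ℤ.pos-* 1 (suc d))) (sym (ℤ.pos-* m 2)) lt′))

½≤/ : ∀ m d .{{_ : NonZero d}} → d ≤ 2 * m → ½ ℚ.≤ ℤ.+ m ℚ./ d
½≤/ m (suc d) le = ℚ.toℚᵘ-cancel-≤ (ℚᵘ.≤-respʳ-≃ (ℚᵘ.≃-sym (ℚ.toℚᵘ-fromℚᵘ (mkℚᵘ (ℤ.+ m) d)))
  (*≤* (subst₂ ℤ._≤_ (ℤ.pos-* 1 (suc d)) (ℤ.pos-* m 2)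
    (ℤ.+≤+ (subst₂ _≤_ (sym (*-identityˡ (suc d))) (*-comm 2 m) le)))))

side-↑ˡ : ∀ {r} (i : Fin r) → side r r (i ↑ˡ r) ≡ true
side-↑ˡ {r} i rewrite Fin.splitAt-↑ˡ r i r = refl

side-↑ʳ : ∀ {r} (j : Fin r) → side r r (r ↑ʳ j) ≡ false
side-↑ʳ {r} j rewrite Fin.splitAt-↑ʳ r r j = refl

edges-↑ : ∀ {r} (i j : Fin r) → (i ↑ˡ r , r ↑ʳ j) ∈ edges (K r r)
edges-↑ {r} i j = ∈-filter⁺ (λ (i , j) → (i Fin.<? j) ×-dec adj? (K r r) i j)
  (∈-cartesianProduct⁺ (∈-allFin (i ↑ˡ r)) (∈-allFin (r ↑ʳ j)))
  (subst₂ _<_ (sym (Fin.toℕ-↑ˡ i r)) (sym (Fin.toℕ-↑ʳ r j))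
      (<-≤-trans (Fin.toℕ<n i) (m≤m+n r (toℕ j))) ,
   λ eq → contradiction (trans (sym (side-↑ˡ i)) (trans eq (side-↑ʳ j))) λ ())

-- Upper bound: from the graph to integer weights and back.

module Upper {q n} (7000≤q : 7000 ≤ q) (G : Graph n) (P : Partite (K (suc q) (suc q)) G)
             (dense : ∀ (i j : Fin (suc q)) → ∣ part P (i ↑ˡ suc q) ∣ * ∣ part P (suc q ↑ʳ j) ∣ <
                              2 * e G (part P (i ↑ˡ suc q)) (part P (suc q ↑ʳ j))) where

  private
    r = suc q

  idx : Fin n → Fin (r + r)
  idx v = proj₁ (partition P v)

  in-idx : ∀ v → v ∈ₛ part P (idx v)
  in-idx v = proj₁ (proj₂ (partition P v))

  idx-unique : ∀ {v i} → v ∈ₛ part P i → idx v ≡ i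
  idx-unique {v} = proj₂ (proj₂ (partition P v))

  size : Fin (r + r) → ℕ
  size i = ∣ part P i ∣

  size-nonZero : ∀ i → NonZero (size i)
  size-nonZero i = ∣∣-nonZero (nonempty P i)

  -- A common multiple of the part sizes, so that the weight `N / size i` of a vertex in part `i` is
  -- an integer and every part has mass `N`.
  N : ℕ
  N = product (List.map size (allFin (r + r)))

  0<N : 0 < N
  0<N = >-nonZero⁻¹ N {{product≢0 (All.map⁺ (All.tabulate {xs = allFin (r + r)} λ {i} _ →
      size-nonZero i))}}

  size∣N : ∀ i → size i ∣ N
  size∣N i = ∈⇒∣product (∈-map⁺ size (∈-allFin i))

  weight : Fin (r + r) → ℕ
  weight i = quotient (size∣N i)

  weight*size : ∀ i → weight i * size i ≡ N
  weight*size i = sym (_∣_.equality (size∣N i))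

  0<weight : ∀ i → 0 < weight i
  0<weight i with weight i | weight*size i
  ... | zero  | eq = contradiction (subst (0 <_) (sym eq) 0<N) λ ()
  ... | suc _ | _  = s≤s z≤n

  -- Both sides are encoded on all of `Fin n`. A vertex of the wrong side gets the default part
  -- `zero` but weight 0, so no mass changes, and `E` holds only pairs with the left vertex first.
  pA pB : Fin n → Fin r
  pA v = Sum.[ id , const zero ] (splitAt r (idx v))
  pB v = Sum.[ const zero , id ] (splitAt r (idx v))

  wA wB : Fin n → ℕ
  wA v = Sum.[ (λ _ → weight (idx v)) , const 0 ] (splitAt r (idx v))
  wB v = Sum.[ const 0 , (λ _ → weight (idx v)) ] (splitAt r (idx v))

  isA : Fin n → Bool
  isA v = side r r (idx v)

  E : Fin n → Fin n → Bool
  E u v = does (adj? G u v) ∧ isA u ∧ not (isA v)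

  ∉⇒false : ∀ {i v} → idx v ≢ i → lookup (part P i) v ≡ false
  ∉⇒false {i} {v} ≢ = ¬-not λ eq → ≢ (idx-unique (lookup⇒[]= v (part P i) eq))

  ∈⇒true : ∀ {i v} → idx v ≡ i → lookup (part P i) v ≡ true
  ∈⇒true {v = v} refl = []=⇒lookup (in-idx v)

  matching : ∀ {i v} → idx v ≡ i → weight (idx v) * 1 ≡ weight i * ⟦ lookup (part P i) v ⟧
  matching {v = v} refl = cong (λ b → weight (idx v) * ⟦ b ⟧) (sym (∈⇒true {v = v} refl))

  inPart-A : ∀ i v → inPart pA wA i v ≡ weight (i ↑ˡ r) * ⟦ lookup (part P (i ↑ˡ r)) v ⟧
  inPart-A i v with splitAt r (idx v) in eq
  ... | inj₂ j = sym (trans (cong (λ b → weight (i ↑ˡ r) * ⟦ b ⟧) (∉⇒false λ idx≡ →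
          contradiction (trans (sym eq) (trans (cong (splitAt r) idx≡) (Fin.splitAt-↑ˡ r i r))) λ ()))
              (*-zeroʳ (weight (i ↑ˡ r))))
  ... | inj₁ i′ with i′ Fin.≟ i
  ...   | yes refl = matching (sym (Fin.splitAt⁻¹-↑ˡ eq))
  ...   | no i′≢i  = trans (*-zeroʳ (weight (idx v))) (sym
          (trans (cong (λ b → weight (i ↑ˡ r) * ⟦ b ⟧) (∉⇒false λ idx≡ →
          i′≢i (inj₁-injective (trans (sym eq) (trans (cong (splitAt r) idx≡)
              (Fin.splitAt-↑ˡ r i r)))))) (*-zeroʳ (weight (i ↑ˡ r)))))

  inPart-B : ∀ j v → inPart pB wB j v ≡ weight (r ↑ʳ j) * ⟦ lookup (part P (r ↑ʳ j)) v ⟧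
  inPart-B j v with splitAt r (idx v) in eq
  ... | inj₁ i = sym (trans (cong (λ b → weight (r ↑ʳ j) * ⟦ b ⟧) (∉⇒false λ idx≡ →
          contradiction (trans (sym eq) (trans (cong (splitAt r) idx≡) (Fin.splitAt-↑ʳ r r j))) λ ()))
              (*-zeroʳ (weight (r ↑ʳ j))))
  ... | inj₂ j′ with j′ Fin.≟ j
  ...   | yes refl = matching (sym (Fin.splitAt⁻¹-↑ʳ eq))
  ...   | no j′≢j  = trans (*-zeroʳ (weight (idx v))) (sym
          (trans (cong (λ b → weight (r ↑ʳ j) * ⟦ b ⟧) (∉⇒false λ idx≡ →
          j′≢j (inj₂-injective (trans (sym eq) (trans (cong (splitAt r) idx≡)
              (Fin.splitAt-↑ʳ r r j)))))) (*-zeroʳ (weight (r ↑ʳ j)))))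

  mass-of : ∀ i (f : Fin n → ℕ) → (∀ v → f v ≡ weight i * ⟦ lookup (part P i) v ⟧) → sum f ≡ N
  mass-of i f f≡ = begin
    sum f                                              ≡⟨ sum-cong-≗ f≡ ⟩
    sum (λ v → weight i * ⟦ lookup (part P i) v ⟧)
      ≡⟨ *-distribˡ-sum (weight i) (λ v → ⟦ lookup (part P i) v ⟧) ⟨
    weight i * sum (λ v → ⟦ lookup (part P i) v ⟧)     ≡⟨ cong (weight i *_) (∣∣-sum (part P i)) ⟨
    weight i * size i                                  ≡⟨ weight*size i ⟩
    N                                                  ∎
    where open ≡-Reasoning

  isA-part : ∀ {i v} → lookup (part P i) v ≡ true → isA v ≡ side r r i
  isA-part {i} {v} eq = cong (side r r) (idx-unique (lookup⇒[]= v (part P i) eq))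

  -- On these two parts the side conditions in `E` hold by themselves, and the weights are constant.
  edges-between : ∀ i j → sum (λ u → inPart pA wA i u * μ (inPart pB wB j) (E u)) ≡
                          weight (i ↑ˡ r) * weight (r ↑ʳ j) * e G (part P (i ↑ˡ r)) (part P (r ↑ʳ j))
  edges-between i j = begin
    sum (λ u → inPart pA wA i u * sum λ v → inPart pB wB j v * ⟦ E u v ⟧)
      ≡⟨ sum-cong-≗ (λ u → *-distribˡ-sum (inPart pA wA i u) λ v → inPart pB wB j v * ⟦ E u v ⟧) ⟩
    sum (λ u → sum λ v → inPart pA wA i u * (inPart pB wB j v * ⟦ E u v ⟧))
      ≡⟨ sum-cong-≗ (λ u → sum-cong-≗ λ v → trans (cong₂ (λ x y → x * (y * ⟦ E u v ⟧)) (inPart-A i u)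
          (inPart-B j v)) (pointwise u v)) ⟩
    sum (λ u → sum λ v → a * b * term u v)
      ≡⟨ sum-cong-≗ (λ u → *-distribˡ-sum (a * b) (term u)) ⟨
    sum (λ u → a * b * sum (term u))
      ≡⟨ *-distribˡ-sum (a * b) (λ u → sum (term u)) ⟨
    a * b * sum (λ u → sum (term u))
      ≡⟨ cong (a * b *_) (e-sum G X Y) ⟨
    a * b * e G X Y ∎
    where
    open ≡-Reasoning
    a = weight (i ↑ˡ r)
    b = weight (r ↑ʳ j)
    X = part P (i ↑ˡ r)
    Y = part P (r ↑ʳ j)
    term : Fin n → Fin n → ℕ
    term u v = ⟦ lookup X u ∧ lookup Y v ∧ does (adj? G u v) ⟧
    bool : ∀ x y z s t → (x ≡ true → s ≡ true) → (y ≡ true → t ≡ false) →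
           a * ⟦ x ⟧ * (b * ⟦ y ⟧ * ⟦ z ∧ s ∧ not t ⟧) ≡ a * b * ⟦ x ∧ y ∧ z ⟧
    bool false y z s t _ _ = trans (cong (_* (b * ⟦ y ⟧ * ⟦ z ∧ s ∧ not t ⟧)) (*-zeroʳ a))
        (sym (*-zeroʳ (a * b)))
    bool true false z s t _ _ = trans (cong (λ x → a * 1 * (x * ⟦ z ∧ s ∧ not t ⟧)) (*-zeroʳ b))
        (trans (*-zeroʳ (a * 1)) (sym (*-zeroʳ (a * b))))
    bool true true z s t s≡ t≡ rewrite s≡ refl | t≡ refl with z
    ... | true  = identity a b
      where
      identity : ∀ a b → a * 1 * (b * 1 * 1) ≡ a * b * 1
      identity = solve-∀
    ... | false = trans (cong (a * 1 *_) (*-zeroʳ (b * 1)))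
            (trans (*-zeroʳ (a * 1)) (sym (*-zeroʳ (a * b))))
    pointwise : ∀ u v → a * ⟦ lookup X u ⟧ * (b * ⟦ lookup Y v ⟧ * ⟦ E u v ⟧) ≡ a * b * term u v
    pointwise u v = bool (lookup X u) (lookup Y v) (does (adj? G u v)) (isA u) (isA v)
      (λ eq → trans (isA-part eq) (side-↑ˡ i)) (λ eq → trans (isA-part eq) (side-↑ʳ j))

  normalised-dense : ∀ i j → N * N < 2 * sum (λ u → inPart pA wA i u * μ (inPart pB wB j) (E u))
  normalised-dense i j = begin-strict
    N * N
      ≡⟨ cong₂ _*_ (weight*size (i ↑ˡ r)) (weight*size (r ↑ʳ j)) ⟨
    a * x * (b * y)                              ≡⟨ identity₁ a x b y ⟩
    a * b * (x * y)
      <⟨ *-monoʳ-< (a * b) {{>-nonZero (*-mono-≤ (0<weight (i ↑ˡ r)) (0<weight (r ↑ʳ j)))}}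
          (dense i j) ⟩
    a * b * (2 * e G (part P (i ↑ˡ r)) (part P (r ↑ʳ j)))    ≡⟨ identity₂ (a * b) _ ⟩
    2 * (a * b * e G (part P (i ↑ˡ r)) (part P (r ↑ʳ j)))    ≡⟨ cong (2 *_) (edges-between i j) ⟨
    2 * sum (λ u → inPart pA wA i u * μ (inPart pB wB j) (E u)) ∎
    where
    open ≤-Reasoning
    a = weight (i ↑ˡ r)
    b = weight (r ↑ʳ j)
    x = size (i ↑ˡ r)
    y = size (r ↑ʳ j)
    identity₁ : ∀ a x b y → a * x * (b * y) ≡ a * b * (x * y)
    identity₁ = solve-∀
    identity₂ : ∀ c d → c * (2 * d) ≡ 2 * (c * d)
    identity₂ = solve-∀

  spanning : Spanning E pA pB
  spanning = dense⇒spanning {q} {N} {wA = wA} {wB} record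
    { massA = λ i → mass-of (i ↑ˡ r) (inPart pA wA i) (inPart-A i)
    ; massB = λ j → mass-of (r ↑ʳ j) (inPart pB wB j) (inPart-B j)
    ; dense = normalised-dense
    } 7000≤q 0<N v₀ v₀
    where v₀ = proj₁ (nonempty P zero)

  idx-A : ∀ {u} → isA u ≡ true → idx u ≡ pA u ↑ˡ r
  idx-A {u} t with splitAt r (idx u) in eq
  ... | inj₁ i = sym (Fin.splitAt⁻¹-↑ˡ eq)

  idx-B : ∀ {v} → isA v ≡ false → idx v ≡ r ↑ʳ pB v
  idx-B {v} t with splitAt r (idx v) in eq
  ... | inj₂ j = sym (Fin.splitAt⁻¹-↑ʳ eq)

  E⇒Adj : ∀ {u v} → E u v ≡ true → Adj G u v
  E⇒Adj {u} {v} t with adj? G u v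
  ... | yes a = a

  E⇒sides : ∀ {u v} → E u v ≡ true → isA u ≡ true × isA v ≡ false
  E⇒sides {u} {v} t =
    let a , s = ∧-true {does (adj? G u v)} t
        p , q = ∧-true {isA u} s
    in p , not-injective q

  module Traversal {LA LB} (c : Cluster E pA pB LA LB) (covA : Covers pA LA) (covB : Covers pB LB) where

    x y : Fin r → Fin n
    x i = proj₁ (covA i)
    y j = proj₁ (covB j)

    -- A priori `x i` could be a right vertex with the default part `zero`; an edge of `E` starting
    -- at it excludes this.
    idx-x : ∀ i → idx (x i) ≡ i ↑ˡ r
    idx-x i with has-edge c (proj₁ (proj₂ (covA i)))
    ... | inj₁ (_ , refl) = contradiction (proj₁ (proj₂ (covB zero))) λ ()
    ... | inj₂ (v , e)    = trans (idx-A (proj₁ (E⇒sides e))) (cong (_↑ˡ r) (proj₂ (proj₂ (covA i))))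

    idx-y : ∀ j → idx (y j) ≡ r ↑ʳ j
    idx-y j with has-edge (swap c) (proj₁ (proj₂ (covB j)))
    ... | inj₁ (_ , refl) = contradiction (proj₁ (proj₂ (covA zero))) λ ()
    ... | inj₂ (u , e)    = trans (idx-B (proj₂ (E⇒sides e))) (cong (r ↑ʳ_) (proj₂ (proj₂ (covB j))))

    φ : Fin (r + r) → Fin n
    φ k = Sum.[ x , y ] (splitAt r k)

    φ-↑ˡ : ∀ i → φ (i ↑ˡ r) ≡ x i
    φ-↑ˡ i = cong Sum.[ x , y ] (Fin.splitAt-↑ˡ r i r)

    φ-↑ʳ : ∀ j → φ (r ↑ʳ j) ≡ y j
    φ-↑ʳ j = cong Sum.[ x , y ] (Fin.splitAt-↑ʳ r r j)

    idx-φ : ∀ k → idx (φ k) ≡ k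
    idx-φ k with splitAt r k in eq
    ... | inj₁ i = trans (idx-x i) (Fin.splitAt⁻¹-↑ˡ eq)
    ... | inj₂ j = trans (idx-y j) (Fin.splitAt⁻¹-↑ʳ eq)

    S : Graph (r + r)
    S = record
      { Adj    = λ k l → Adj G (φ k) (φ l)
      ; adj?   = λ k l → adj? G (φ k) (φ l)
      ; symm   = symm G
      ; irrefl = λ { refl → irrefl G refl }
      }

    S-edge : ∀ {u v} → u ∈ LA → v ∈ LB → E u v ≡ true → Adj S (pA u ↑ˡ r) (r ↑ʳ pB v)
    S-edge {u} {v} u∈ v∈ e = subst₂ (Adj G) (sym u≡) (sym v≡) (E⇒Adj e)
      where
      u≡ : φ (pA u ↑ˡ r) ≡ u
      u≡ = trans (φ-↑ˡ (pA u)) (part-injective c (proj₁ (proj₂ (covA (pA u)))) u∈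
          (proj₂ (proj₂ (covA (pA u)))))
      v≡ : φ (r ↑ʳ pB v) ≡ v
      v≡ = trans (φ-↑ʳ (pB v)) (part-injective (swap c) (proj₁ (proj₂ (covB (pB v)))) v∈
          (proj₂ (proj₂ (covB (pB v)))))

    S-connected : ∃[ ρ ] ∀ k → Star (Adj S) k ρ
    S-connected with ρ , A→ρ , B→ρ ← cluster-connected (λ {k} {l} → symm S {k} {l}) (λ u → pA u ↑ˡ r)
        (λ v → r ↑ʳ pB v) c S-edge = ρ , toRoot
      where
      toRoot : ∀ k → Star (Adj S) k ρ
      toRoot k with splitAt r k in eq
      ... | inj₁ i = subst (λ k → Star (Adj S) k ρ) (trans (cong (_↑ˡ r) (proj₂ (proj₂ (covA i))))
              (Fin.splitAt⁻¹-↑ˡ eq)) (A→ρ (proj₁ (proj₂ (covA i))))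
      ... | inj₂ j = subst (λ k → Star (Adj S) k ρ) (trans (cong (r ↑ʳ_) (proj₂ (proj₂ (covB j))))
              (Fin.splitAt⁻¹-↑ʳ eq)) (B→ρ (proj₁ (proj₂ (covB j))))

    hasTraversal : HasTraversal (𝒯 (2 * r)) P
    hasTraversal =
      let ρ , reachable = S-connected
          T , T-tree , T⊆S = spanningTree S ρ reachable
      -- The spanning tree itself serves both as the traversal and as the member of the family.
      in T
       , record { vertex = φ ; injective = λ {k} {l} eq → trans (sym (idx-φ k))
           (trans (cong idx eq) (idx-φ l)) ; edge = T⊆S }
       , (λ k → k , subst (λ l → φ k ∈ₛ part P l) (idx-φ k) (in-idx (φ k)) , λ {l} l∈ → trans
           (sym (idx-unique l∈)) (idx-φ l))
       , r + r , T , (cong (λ s → r + s) (sym (+-identityʳ r)) , T-tree)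
       , record { vertex = id ; injective = id ; edge = id }

  hasTraversal : HasTraversal (𝒯 (2 * r)) P
  hasTraversal = let _ , _ , c , covA , covB = spanning in Traversal.hasTraversal c covA covB

admissible≤½ : ∀ r → r > 7000 → ∀ α → Admissible (K r r) (𝒯 (2 * r)) α → α ℚ.≤ ½
admissible≤½ (suc q) (s≤s 7000≤q) α (_ , _ , n , G , P , α≤density , none) = ℚ.≮⇒≥ λ ½<α →
  none (Upper.hasTraversal 7000≤q G P λ i j →
    ½</⇒ (e G (X i) (Y j)) (∣ X i ∣ * ∣ Y j ∣) {{m*n≢0 ∣ X i ∣ ∣ Y j ∣ {{∣∣-nonZero (nonempty P _)}}
        {{∣∣-nonZero (nonempty P _)}}}}
      (ℚ.<-≤-trans ½<α (ℚ.≤-trans α≤density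
        (All.lookup (Extrema.min≤xs 1ℚ (List.map dens (edges (K r r)))) (∈-map⁺ dens (edges-↑ i j))))))
  where
  r = suc q
  X Y : Fin r → Subset n
  X i = part P (i ↑ˡ r)
  Y j = part P (r ↑ʳ j)
  dens : Fin (r + r) × Fin (r + r) → ℚ
  dens (i , j) = density G (part P i) (part P j) (nonempty P i) (nonempty P j)

-- Lower bound: the labelled construction.

∑-splitAt : ∀ k {l} (f : Fin (k + l) → ℕ) → sum f ≡ sum (λ i → f (i ↑ˡ l)) + sum (λ j → f (k ↑ʳ j))
∑-splitAt zero    f = refl
∑-splitAt (suc k) f = trans (cong (f zero +_) (∑-splitAt k (f ∘ suc))) (sym (+-assoc (f zero) _ _))

∑-combine : ∀ m {k} (f : Fin (m * k) → ℕ) → sum f ≡ sum {m} λ i → sum {k} λ j → f (combine i j)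
∑-combine zero        f = refl
∑-combine (suc m) {k} f = trans (∑-splitAt k f) (cong (sum (λ j → f (j ↑ˡ m * k)) +_)
    (∑-combine m (f ∘ (k ↑ʳ_))))

-- A missed value could be punched out, leaving an injection of `Fin (suc n)` into `Fin n`.
injective⇒surjective : ∀ {n} {f : Fin n → Fin n} → Injective _≡_ _≡_ f → ∀ y → ∃[ x ] f x ≡ y
injective⇒surjective {suc n} {f} inj y with Fin.any? (λ x → f x Fin.≟ y)
... | yes p = p
... | no ¬p = contradiction (Fin.injective⇒≤ λ {x} {x′} eq → inj
        (Fin.punchOut-injective (y≢f x) (y≢f x′) eq)) 1+n≰n
  where
  y≢f : ∀ x → y ≢ f x
  y≢f x eq = ¬p (x , sym eq)

½≤partiteDensity : ∀ {m n} (H : Graph m) (G : Graph n) (P : Partite H G) →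
                   (∀ i j → i Fin.< j → Adj H i j → ½ ℚ.≤ density G (part P i) (part P j)
                       (nonempty P i) (nonempty P j)) →
                   ½ ℚ.≤ partiteDensity H G P
½≤partiteDensity {m} H G P dense = Extrema.v≤min⁺ (toWitness {a? = ½ ℚ.≤? 1ℚ} _)
    (All.map⁺ (All.tabulate {xs = edges H} λ {(i , j)} ij∈ →
  let i<j , ij = proj₂ (∈-filter⁻ (λ (i , j) → (i Fin.<? j) ×-dec adj? H i j)
          {xs = cartesianProduct (allFin m) (allFin m)} ij∈)
  in dense i j i<j ij))

-- Each part consists of two vertices.  On the left, both carry the label [i = z];
-- on the right, they carry different labels.  Edges join equal labels, so a connected
-- subgraph has a single label and misses the part z or the part o on the left.
module Lower {r} (z o : Fin r) (o≢z : o ≢ z) where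

  n : ℕ
  n = (r + r) * 2

  quot : Fin n → Fin (r + r)
  quot v = proj₁ (remQuot {r + r} 2 v)

  label′ : Fin r ⊎ Fin r → Fin 2 → Bool
  label′ (inj₁ i) c = does (i Fin.≟ z)
  label′ (inj₂ j) c = does (c Fin.≟ zero)

  label : Fin n → Bool
  label v = label′ (splitAt r (quot v)) (proj₂ (remQuot {r + r} 2 v))

  slot : Fin (r + r) → Fin 2 → Fin n
  slot = combine

  quot-slot : ∀ k c → quot (slot k c) ≡ k
  quot-slot k c = cong proj₁ (Fin.remQuot-combine {r + r} {2} k c)

  label-slot : ∀ k c → label (slot k c) ≡ label′ (splitAt r k) c
  label-slot k c = cong₂ (λ k c → label′ (splitAt r k) c) (quot-slot k c)
      (cong proj₂ (Fin.remQuot-combine {r + r} {2} k c))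

  sideOf : Fin n → Bool
  sideOf v = side r r (quot v)

  G : Graph n
  G = record
    { Adj    = λ u v → sideOf u ≢ sideOf v × label u ≡ label v
    ; adj?   = λ u v → ¬? (sideOf u ≟ᵇ sideOf v) ×-dec (label u ≟ᵇ label v)
    ; symm   = λ (s , l) → ≢-sym s , sym l
    ; irrefl = λ { refl (s , _) → s refl }
    }

  block : Fin (r + r) → Subset n
  block k = tabulate λ v → does (quot v Fin.≟ k)

  ∈-block : ∀ v → v ∈ₛ block (quot v)
  ∈-block v = lookup⇒[]= v _ (trans (lookup∘tabulate (λ w → does (quot w Fin.≟ quot v)) v)
      (dec-true (quot v Fin.≟ quot v) refl))

  block-∈ : ∀ {v k} → v ∈ₛ block k → quot v ≡ k
  block-∈ {v} {k} v∈ with quot v Fin.≟ k | trans (sym (lookup∘tabulate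
      (λ w → does (quot w Fin.≟ k)) v)) ([]=⇒lookup v∈)
  ... | yes eq | _ = eq

  P : Partite (K r r) G
  P = record
    { part        = block
    ; nonempty    = λ k → slot k zero , subst (λ l → slot k zero ∈ₛ block l) (quot-slot k zero)
        (∈-block (slot k zero))
    ; partition   = λ v → quot v , ∈-block v , block-∈
    ; independent = λ u∈ v∈ (s , _) → s (cong (side r r) (trans (block-∈ u∈) (sym (block-∈ v∈))))
    ; between     = λ _ u∈ v∈ (s , _) eq → s (trans (cong (side r r) (block-∈ u∈))
        (trans eq (sym (cong (side r r) (block-∈ v∈)))))
    }

  ∣block∣ : ∀ k → ∣ block k ∣ ≡ 2
  ∣block∣ k = begin
    ∣ block k ∣                                                 ≡⟨ ∣∣-sum (block k) ⟩
    sum (λ v → ⟦ lookup (block k) v ⟧)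
      ≡⟨ sum-cong-≗ (λ v → cong ⟦_⟧ (lookup∘tabulate (λ w → does (quot w Fin.≟ k)) v)) ⟩
    sum (λ v → ⟦ does (quot v Fin.≟ k) ⟧)
      ≡⟨ ∑-combine (r + r) {2} (λ v → ⟦ does (quot v Fin.≟ k) ⟧) ⟩
    sum (λ l → sum λ c → ⟦ does (quot (slot l c) Fin.≟ k) ⟧)
      ≡⟨ sum-cong-≗ (λ l → sum-cong-≗ λ c → cong (λ l → ⟦ does (l Fin.≟ k) ⟧) (quot-slot l c)) ⟩
    sum (λ l → 2 * ⟦ does (l Fin.≟ k) ⟧)
      ≡⟨ *-distribˡ-sum 2 (λ l → ⟦ does (l Fin.≟ k) ⟧) ⟨
    2 * sum (λ l → ⟦ does (l Fin.≟ k) ⟧)                        ≡⟨ cong (2 *_) (∑-one k) ⟩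
    2                                                           ∎
    where open ≡-Reasoning

  in-block : ∀ k c → lookup (block k) (slot k c) ≡ true
  in-block k c = trans (lookup∘tabulate (λ w → does (quot w Fin.≟ k)) (slot k c))
          (dec-true (quot (slot k c) Fin.≟ k) (quot-slot k c))

  -- Both vertices of the left part carry the label `[i = z]`, and the vertex in slot `c′` of the
  -- right part carries it too.
  2≤e : ∀ i j → 2 ≤ e G (block (i ↑ˡ r)) (block (r ↑ʳ j))
  2≤e i j = begin
    2
      ≤⟨ +-mono-≤ (row zero) (+-monoˡ-≤ 0 (row (suc zero))) ⟩
    sum (λ c → sum (term (slot k c)))                ≤⟨ ∑-≤ (λ k → sum λ c → sum (term (slot k c))) k ⟩
    sum (λ k → sum λ c → sum (term (slot k c)))      ≡⟨ ∑-combine (r + r) {2} (λ u → sum (term u)) ⟨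
    sum (λ u → sum (term u))                            ≡⟨ e-sum G (block k) (block l) ⟨
    e G (block k) (block l)                             ∎
    where
    open ≤-Reasoning
    k = i ↑ˡ r
    l = r ↑ʳ j
    term : Fin n → Fin n → ℕ
    term u v = ⟦ lookup (block k) u ∧ lookup (block l) v ∧ does (adj? G u v) ⟧
    bit : ∀ b → ∃[ c ] does (c Fin.≟ zero {1}) ≡ b
    bit true  = zero , refl
    bit false = suc zero , refl
    c′ = proj₁ (bit (does (i Fin.≟ z)))
    sides : ∀ c → sideOf (slot k c) ≢ sideOf (slot l c′)
    sides c eq = contradiction (trans (sym (trans (cong (side r r) (quot-slot k c)) (side-↑ˡ i)))
                                      (trans eq (trans (cong (side r r) (quot-slot l c′))
                                          (side-↑ʳ j)))) λ ()
    labels : ∀ c → label (slot k c) ≡ label (slot l c′)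
    labels c = trans (trans (label-slot k c) (cong (λ s → label′ s c) (Fin.splitAt-↑ˡ r i r)))
      (trans (sym (proj₂ (bit (does (i Fin.≟ z)))))
             (sym (trans (label-slot l c′) (cong (λ s → label′ s c′) (Fin.splitAt-↑ʳ r r j)))))
    row : ∀ c → 1 ≤ sum (term (slot k c))
    row c = ≤-trans (≤-reflexive (sym (cong ⟦_⟧ (cong₂ _∧_ (in-block k c) (cong₂ _∧_ (in-block l c′)
                      (dec-true (adj? G (slot k c) (slot l c′)) (sides c , labels c)))))))
                    (∑-≤ (term (slot k c)) (slot l c′))

  -- Left indices precede right ones, so `i < j` settles which end is on the left.
  edge-form : ∀ {i j : Fin (r + r)} → i Fin.< j → side r r i ≢ side r r j → ∃₂ λ i′ j′ → i ≡ i′ ↑ˡ r ×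
      j ≡ r ↑ʳ j′
  edge-form {i} {j} i<j sides with splitAt r i in eqi | splitAt r j in eqj
  ... | inj₁ i′ | inj₂ j′ = i′ , j′ , sym (Fin.splitAt⁻¹-↑ˡ eqi) , sym (Fin.splitAt⁻¹-↑ʳ eqj)
  ... | inj₁ i′ | inj₁ j′ = contradiction refl sides
  ... | inj₂ i′ | inj₂ j′ = contradiction refl sides
  ... | inj₂ i′ | inj₁ j′ = contradiction i<j (<⇒≯ (begin-strict
    toℕ j            ≡⟨ cong toℕ (Fin.splitAt⁻¹-↑ˡ eqj) ⟨
    toℕ (j′ ↑ˡ r)    ≡⟨ Fin.toℕ-↑ˡ j′ r ⟩
    toℕ j′           <⟨ Fin.toℕ<n j′ ⟩
    r                ≤⟨ m≤m+n r (toℕ i′) ⟩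
    r + toℕ i′       ≡⟨ Fin.toℕ-↑ʳ r i′ ⟨
    toℕ (r ↑ʳ i′)    ≡⟨ cong toℕ (Fin.splitAt⁻¹-↑ʳ eqi) ⟩
    toℕ i            ∎))
    where open ≤-Reasoning

  ½≤Density : Fin (r + r) → Fin (r + r) → Set
  ½≤Density k l = ½ ℚ.≤ density G (block k) (block l) (nonempty P k) (nonempty P l)

  ½≤density-↑ : ∀ i j → ½≤Density (i ↑ˡ r) (r ↑ʳ j)
  ½≤density-↑ i j = ½≤/ (e G X Y) (∣ X ∣ * ∣ Y ∣)
    {{m*n≢0 ∣ X ∣ ∣ Y ∣ {{∣∣-nonZero (nonempty P (i ↑ˡ r))}} {{∣∣-nonZero (nonempty P (r ↑ʳ j))}}}}
    (subst (_≤ 2 * e G X Y) (sym (cong₂ _*_ (∣block∣ (i ↑ˡ r)) (∣block∣ (r ↑ʳ j))))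
        (*-monoʳ-≤ 2 (2≤e i j)))
    where
    X = block (i ↑ˡ r)
    Y = block (r ↑ʳ j)

  ½≤density : ½ ℚ.≤ partiteDensity (K r r) G P
  ½≤density = ½≤partiteDensity (K r r) G P λ i j i<j sides →
    let i′ , j′ , i≡ , j≡ = edge-form i<j sides
    in subst₂ ½≤Density (sym i≡) (sym j≡) (½≤density-↑ i′ j′)

  -- A tree on `2 * r` vertices covers the whole traversal by counting, and labels are constant
  -- along its walks; but the vertices in the left parts `z` and `o` have different labels.
  no-traversal : ¬ HasTraversal (𝒯 (2 * r)) P
  no-traversal (S , φ , traversal , k , F , (k≡2r , (_ , connected) , _) , ψ) = contradiction
    (trans (sym (trans (label-of z) (dec-true (z Fin.≟ z) refl)))
           (trans same (trans (label-of o) (dec-false (o Fin.≟ z) o≢z)))) λ ()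
    where
    position : ∀ i → ∃[ s ] quot (vertex φ s) ≡ i
    position i = let s , s∈ , _ = traversal i in s , block-∈ s∈
    first : Fin r → Fin (r + r)
    first i = proj₁ (position (i ↑ˡ r))
    label-of : ∀ i → label (vertex φ (first i)) ≡ does (i Fin.≟ z)
    label-of i = cong (λ s → label′ s (proj₂ (remQuot {r + r} 2 (vertex φ (first i)))))
      (trans (cong (splitAt r) (proj₂ (position (i ↑ˡ r)))) (Fin.splitAt-↑ˡ r i r))
    along : ∀ {u v} → Star (Adj F) u v → label (vertex φ (vertex ψ u)) ≡ label (vertex φ (vertex ψ v))
    along ε        = refl
    along (a ◅ as) = trans (proj₂ (edge φ (edge ψ a))) (along as)
    surjective : ∀ {k} → k ≡ r + r → (f : Fin k → Fin (r + r)) → Injective _≡_ _≡_ f → ∀ y →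
        ∃[ x ] f x ≡ y
    surjective refl f inj = injective⇒surjective inj
    k≡r+r = trans k≡2r (cong (r +_) (+-identityʳ r))
    same : label (vertex φ (first z)) ≡ label (vertex φ (first o))
    same =
      let a , ψa≡ = surjective k≡r+r (vertex ψ) (injective ψ) (first z)
          b , ψb≡ = surjective k≡r+r (vertex ψ) (injective ψ) (first o)
      in subst₂ (λ s t → label (vertex φ s) ≡ label (vertex φ t)) ψa≡ ψb≡ (along (connected a b))

  ½-admissible : Admissible (K r r) (𝒯 (2 * r)) ½
  ½-admissible = toWitness {a? = ℚ.0ℚ ℚ.≤? ½} _ , toWitness {a? = ½ ℚ.≤? 1ℚ} _ , n , G , P ,
      ½≤density , no-traversal

½-admissible : ∀ r → r > 7000 → Admissible (K r r) (𝒯 (2 * r)) ½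
½-admissible (suc (suc r)) _        = Lower.½-admissible zero (suc zero) λ ()
½-admissible (suc zero)    (s≤s ())

theorem1p3 : ∀ (r : ℕ) → r > 7000 → CriticalDensity≡ (K r r) (𝒯 (2 * r)) ½
theorem1p3 r r>7000 = admissible≤½ r r>7000 , λ β bound → bound ½ (½-admissible r r>7000)
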